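{- Let $C_{132}(x,p,q,r)=\sum_{n\geq0}x^n g(n)$ and $L(x;v)=\sum_{n\geq1}L_n(v)x^n$, where $L_n(v)=\sum_{i=1}^n g(n|ii)v^{i-1}$. Then $$C_{132}(x,p,q,r)=1+\frac{1+r(q-p)x}{1-prx}L(x;1),$$ and $L(x;v)$ satisfies $$\left((1-prx)^2-\frac{pqvx(1+r(q-p)x)}{1-v}\right)L(x;v)=px(1-prx)-\frac{pqxv(1-prx)(1+(q-p)rxv)}{(1-prxv)(1-v)}L(xv;1).$$
   Context: A Stirling permutation of order $n$ is a permutation $\sigma=\sigma_1\cdots\sigma_{2n}$ of the multiset $\{1,1,2,2,\ldots,n,n\}$ such that, for each $i\in[n]$, every entry between the two occurrences of $i$ is greater than $i$; $\mathcal{Q}_n$ is the set of these ($\mathcal{Q}_0$ consists of the empty word). For $\sigma\in\mathcal{Q}_n$: $\mathrm{des}(\sigma)$, $\mathrm{asc}(\sigma)$, $\mathrm{plat}(\sigma)$ are the numbers of $i\in\{1,\dots,2n-1\}$ with $\sigma_i>\sigma_{i+1}$, $\sigma_i<\sigma_{i+1}$, $\sigma_i=\sigma_{i+1}$ respectively. $\mathcal{Q}_n(132)$ is the set of $\sigma\in\mathcal{Q}_n$ with no subsequence $\sigma_{i_1}\sigma_{i_2}\sigma_{i_3}$ ($i_1<i_2<i_3$) satisfying $\sigma_{i_1}<\sigma_{i_3}<\sigma_{i_2}$. $g(n)=\sum_{\sigma\in\mathcal{Q}_n(132)}p^{\mathrm{plat}(\sigma)}q^{\mathrm{des}(\sigma)}r^{\mathrm{asc}(\sigma)}$,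 and $g(n|ii)$ is the same sum restricted to those $\sigma\in\mathcal{Q}_n(132)$ whose first two letters are $i,i$. Identities are of formal power series in $x$ with coefficients rational in $p,q,r,v$. -}

module Defs where

open import Data.Nat using (ℕ; zero; suc; _∸_; _≡ᵇ_; _<ᵇ_) renaming (_+_ to _+ℕ_; _*_ to _*ℕ_)
open import Data.Bool using (Bool; true; false; _∧_; _∨_; not; if_then_else_)
open import Data.List using (List; []; _∷_; [_]; length; map; concatMap; upTo; filterᵇ)
open import Data.Bool.ListAction using (any; all)
open import Algebra.Bundles using (CommutativeRing)
open import Level using (Level)

-- entry at 0-based position i (0 outside the word; only used in range)
at : List ℕ → ℕ → ℕ
at []      _       = 0
at (a ∷ w) zero    = a
at (a ∷ w) (suc i) = at w i

count : ℕ → List ℕ → ℕ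
count i []      = 0
count i (a ∷ w) = (if a ≡ᵇ i then 1 else 0) +ℕ count i w

allWords : ℕ → ℕ → List (List ℕ)
allWords n zero    = [ [] ]
allWords n (suc m) = concatMap (λ a → map (a ∷_) (allWords n m)) (map suc (upTo n))

anyTriple : List ℕ → (ℕ → ℕ → ℕ → Bool) → Bool
anyTriple w P =
  any (λ i → any (λ j → any (λ k → (i <ᵇ j) ∧ (j <ᵇ k) ∧ P i j k) ps) ps) ps
  where ps = upTo (length w)

-- w is a permutation of the multiset {1,1,2,2,…,n,n} (w has length 2n,
-- each i ∈ [n] occurs exactly twice) and, for each letter, every entry
-- between its two occurrences is greater than it.
isStirling : ℕ → List ℕ → Bool
isStirling n w =
  (length w ≡ᵇ (2 *ℕ n))
  ∧ all (λ i → count (suc i) w ≡ᵇ 2) (upTo n)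
  ∧ not (anyTriple w (λ i j k → (at w i ≡ᵇ at w k) ∧ not (at w i <ᵇ at w j)))

avoids132 : List ℕ → Bool
avoids132 w = not (anyTriple w (λ i j k → (at w i <ᵇ at w k) ∧ (at w k <ᵇ at w j)))

Q132 : ℕ → List (List ℕ)
Q132 n = filterᵇ (λ w → isStirling n w ∧ avoids132 w) (allWords n (2 *ℕ n))

Q132ii : ℕ → ℕ → List (List ℕ)
Q132ii n i = filterᵇ startsii (Q132 n)
  where
  startsii : List ℕ → Bool
  startsii (a ∷ b ∷ _) = (a ≡ᵇ i) ∧ (b ≡ᵇ i)
  startsii _           = false

des asc plat : List ℕ → ℕ
des (a ∷ b ∷ w) = (if b <ᵇ a then 1 else 0) +ℕ des (b ∷ w)
des _ = 0
asc (a ∷ b ∷ w) = (if a <ᵇ b then 1 else 0) +ℕ asc (b ∷ w)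
asc _ = 0
plat (a ∷ b ∷ w) = (if a ≡ᵇ b then 1 else 0) +ℕ plat (b ∷ w)
plat _ = 0

-- Formal power series in x over a commutative ring R
-- (coefficients: R plays the role of a ring containing p,q,r,v)

module Series {c ℓ : Level} (R : CommutativeRing c ℓ) where
  open CommutativeRing R

  pow : Carrier → ℕ → Carrier
  pow a zero    = 1#
  pow a (suc k) = a * pow a k

  sumTo : ℕ → (ℕ → Carrier) → Carrier
  sumTo zero    f = 0#
  sumTo (suc n) f = sumTo n f + f n

  sumList : List Carrier → Carrier
  sumList []      = 0#
  sumList (a ∷ l) = a + sumList l

  PS : Set c
  PS = ℕ → Carrier

  _≋_ : PS → PS → Set ℓ
  f ≋ g = ∀ n → f n ≈ g n
  infix 4 _≋_

  infixl 6 _⊕_ _⊖_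
  infixl 7 _⊗_

  _⊕_ _⊖_ _⊗_ : PS → PS → PS
  (f ⊕ g) n = f n + g n
  (f ⊖ g) n = f n - g n
  (f ⊗ g) n = sumTo (suc n) (λ k → f k * g (n ∸ k))

  ⟨_⟩ : Carrier → PS
  ⟨ a ⟩ zero    = a
  ⟨ a ⟩ (suc _) = 0#

  X : PS
  X (suc zero) = 1#
  X _          = 0#

  -- 1/(1 - a x) = Σ a^n x^n
  geom : Carrier → PS
  geom a n = pow a n

  module Stirling (p q r : Carrier) where

    weight : List ℕ → Carrier
    weight σ = pow p (plat σ) * pow q (des σ) * pow r (asc σ)

    g : ℕ → Carrier
    g n = sumList (map weight (Q132 n))

    gii : ℕ → ℕ → Carrier
    gii n i = sumList (map weight (Q132ii n i))

    C132 : PS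
    C132 n = g n

    Ln : Carrier → ℕ → Carrier
    Ln v n = sumTo n (λ k → gii n (suc k) * pow v k)

    L : Carrier → PS
    L v zero    = 0#
    L v (suc n) = Ln v (suc n)

    -- L(xv;1) = Σ_{n≥1} L_n(1) v^n x^n
    Lxv1 : Carrier → PS
    Lxv1 v n = pow v n * L 1# n

{-# OPTIONS --safe #-}
module Submission where

-- Let h be the first letter of a word σ in Q_n(132). Since σ avoids 132, its
-- letters above h increase, so they begin with (h+1)(h+1). Hence every word of
-- order n + 1 ≥ 2 arises uniquely, after relabelling, from a word σ of order n by
--   * prepending jj with h < j ≤ n + 1, or with j = h when σ starts with hh; or
--   * inserting (h+1)(h+1) right after the first letter.
-- Let L collect the words starting with a doubled letter and N the other nonempty
-- words, the first letter i being marked by v^(i-1). Reading off the weights,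
--   N = qrx L + prx N,
--   L = px + prx L + pqx v/(1-v) (L + N - (L + N)(xv;1)),
-- the last term being the geometric sum of v^(j-1) over h < j ≤ n + 1.
-- The theorem follows by eliminating N.

open import Defs
open import Level using (Level)
open import Data.Product using (_×_; _,_; proj₁; proj₂; ∃-syntax)
open import Algebra.Bundles using (CommutativeRing)
import Algebra.Properties.CommutativeSemigroup as CommutativeSemigroupProperties
import Algebra.Properties.Ring as RingProperties
import Algebra.Solver.Ring.NaturalCoefficients.Default as SemiringSolver
open import Data.Bool using (Bool; true; false; _∧_; not; if_then_else_; T)
open import Data.Bool.ListAction using (any; all)
open import Data.Bool.Properties using (T-∧; T?)
open import Data.List using (List; []; _∷_; [_]; _++_; length; map; concatMap; upTo; applyUpTo; filterᵇ)
open import Data.List.Properties using (map-∘; map-id; length-map; map-cong-local; map-applyUpTo; ∷-injectiveˡ; ∷-injectiveʳ)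
open import Data.List.Membership.Propositional using (_∈_; lose; find)
open import Data.List.Membership.Propositional.Properties using (∈-map⁺; ∈-map⁻; ∈-upTo⁺; ∈-upTo⁻; ∈-concatMap⁺; ∈-concatMap⁻; ∈-filter⁺; ∈-filter⁻)
open import Data.List.Membership.Propositional.Properties.WithK using (unique∧set⇒bag)
open import Data.List.Relation.Binary.BagAndSetEquality using (∼bag⇒↭)
open import Data.List.Relation.Binary.Permutation.Propositional using (_↭_)
open import Data.List.Relation.Unary.All as All using (All; []; _∷_)
import Data.List.Relation.Unary.All.Properties as Allₚ
open import Data.List.Relation.Unary.AllPairs as AllPairs using (AllPairs; []; _∷_)
import Data.List.Relation.Unary.AllPairs.Properties as AllPairsₚ
open import Data.List.Relation.Unary.Any using (here; there)
open import Data.List.Relation.Unary.Any.Properties using (any⁺; any⁻)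
open import Data.List.Relation.Unary.Unique.Propositional using (Unique)
import Data.List.Relation.Unary.Unique.Propositional.Properties as Uniqueₚ
open import Data.Nat using (ℕ; zero; suc; pred; _∸_; _≡ᵇ_; _<ᵇ_; _≤_; _<_; z≤n; s≤s; z<s; s<s) renaming (_+_ to _+ℕ_; _*_ to _*ℕ_)
import Data.Nat.Properties as ℕₚ
open import Data.Unit using (tt)
open import Function using (_∘_; _⇔_; mk⇔; Equivalence)
open import Relation.Binary.PropositionalEquality using (_≡_; _≢_; refl; sym; trans; cong; cong₂; subst; subst₂; module ≡-Reasoning)
import Relation.Binary.Reasoning.Setoid as SetoidReasoning
open import Relation.Nullary using (¬_; yes; no; contradiction)

open Equivalence using (to; from)

-- The tree works because the pair to be removed is always adjacent, in places 1 and 2 or in places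
-- 2 and 3. If the first letter a is not doubled, its other copy comes later, so the second letter
-- exceeds a; and the letters above a, which increase, can then only begin with both copies of a +
-- 1. The same fact limits prepending: for j ≤ h the old first letter becomes h + 1 > j, so it must
-- equal j + 1 and be followed by its twin. This forces j = h and a parent that starts with hh.
--
-- Two series suffice because the weight factor of a child depends only on the construction used and
-- on whether the parent starts with a doubled letter. The number of children, however, depends on
-- the first letter, so v has to be carried along as a catalytic variable. The upper end of the
-- geometric sum depends on the order alone, and this is where the series at (xv;1) comes from. The
-- second series is eliminated both at (x;v) and at (xv;1); only the latter needs an inverse, which
-- is the denominator 1 - prxv.

data AllTriples {A : Set} (R : A → A → A → Set) : List A → Set where
  []  : AllTriples R []
  _∷_ : ∀ {a w} → AllPairs (R a) w → AllTriples R w → AllTriples R (a ∷ w)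

module _ {A : Set} where

  allPairs-second : {P : A → Set} {w : List A} → All P w → AllPairs (λ _ c → P c) w
  allPairs-second []       = []
  allPairs-second (_ ∷ ps) = ps ∷ allPairs-second ps

  allTriples-map : {R S : A → A → A → Set} → (∀ {a b c} → R a b c → S a b c) →
                   ∀ {w} → AllTriples R w → AllTriples S w
  allTriples-map f []       = []
  allTriples-map f (p ∷ ps) = AllPairs.map f p ∷ allTriples-map f ps

  allTriples-map⁺ : {R : A → A → A → Set} {f : A → A} → ∀ {w} →
                    AllTriples (λ a b c → R (f a) (f b) (f c)) w → AllTriples R (map f w)
  allTriples-map⁺ []       = []
  allTriples-map⁺ (p ∷ ps) = AllPairsₚ.map⁺ p ∷ allTriples-map⁺ ps

  allTriples-map⁻ : {R : A → A → A → Set} {f : A → A} → ∀ {w} →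
                    AllTriples R (map f w) → AllTriples (λ a b c → R (f a) (f b) (f c)) w
  allTriples-map⁻ {w = []}    []       = []
  allTriples-map⁻ {w = _ ∷ _} (p ∷ ps) = AllPairsₚ.map⁻ p ∷ allTriples-map⁻ ps

-- Conditions on positions versus conditions on subsequences

all-at⁻ : {P : ℕ → Set} → ∀ w → (∀ k → k < length w → P (at w k)) → All P w
all-at⁻ []      h = []
all-at⁻ (a ∷ w) h = h 0 z<s ∷ all-at⁻ w (λ k k< → h (suc k) (s<s k<))

all-at⁺ : {P : ℕ → Set} → ∀ {w} → All P w → ∀ k → k < length w → P (at w k)
all-at⁺ (p ∷ ps) zero    _        = p
all-at⁺ (p ∷ ps) (suc k) (s≤s k<) = all-at⁺ ps k k<

allPairs-at⁻ : {R : ℕ → ℕ → Set} → ∀ w →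
               (∀ j k → j < k → k < length w → R (at w j) (at w k)) → AllPairs R w
allPairs-at⁻ []      h = []
allPairs-at⁻ (a ∷ w) h = all-at⁻ w (λ k k< → h 0 (suc k) z<s (s<s k<))
                       ∷ allPairs-at⁻ w (λ j k j<k k< → h (suc j) (suc k) (s<s j<k) (s<s k<))

allPairs-at⁺ : {R : ℕ → ℕ → Set} → ∀ {w} → AllPairs R w →
               ∀ j k → j < k → k < length w → R (at w j) (at w k)
allPairs-at⁺ (p ∷ ps) zero    (suc k) _         (s≤s k<) = all-at⁺ p k k<
allPairs-at⁺ (p ∷ ps) (suc j) (suc k) (s≤s j<k) (s≤s k<) = allPairs-at⁺ ps j k j<k k<

allTriples-at⁻ : {R : ℕ → ℕ → ℕ → Set} → ∀ w →
                 (∀ i j k → i < j → j < k → k < length w → R (at w i) (at w j) (at w k)) →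
                 AllTriples R w
allTriples-at⁻ []      h = []
allTriples-at⁻ (a ∷ w) h = allPairs-at⁻ w (λ j k j<k k< → h 0 (suc j) (suc k) z<s (s<s j<k) (s<s k<))
  ∷ allTriples-at⁻ w (λ i j k i<j j<k k< → h (suc i) (suc j) (suc k) (s<s i<j) (s<s j<k) (s<s k<))

allTriples-at⁺ : {R : ℕ → ℕ → ℕ → Set} → ∀ {w} → AllTriples R w →
                 ∀ i j k → i < j → j < k → k < length w → R (at w i) (at w j) (at w k)
allTriples-at⁺ (p ∷ ps) zero    (suc j) (suc k) _         (s≤s j<k) (s≤s k<) = allPairs-at⁺ p j k j<k k<
allTriples-at⁺ (p ∷ ps) (suc i) (suc j) (suc k) (s≤s i<j) (s≤s j<k) (s≤s k<) = allTriples-at⁺ ps i j k i<j j<k k<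

T-not : ∀ b → T (not b) ⇔ (¬ T b)
T-not false = mk⇔ (λ _ ()) (λ _ → tt)
T-not true  = mk⇔ (λ ()) (λ h → h tt)

any-upTo⁺ : ∀ (f : ℕ → Bool) n i → i < n → T (f i) → T (any f (upTo n))
any-upTo⁺ f n i i<n t = any⁺ f (lose (∈-upTo⁺ i<n) t)

any-upTo⁻ : ∀ (f : ℕ → Bool) n → T (any f (upTo n)) → ∃[ i ] (i < n × T (f i))
any-upTo⁻ f n t with i , i∈ , fi ← find (any⁻ f (upTo n) t) = i , ∈-upTo⁻ i∈ , fi

-- Relabelling and adding letters at the front act on lists, not on positions. The Boolean tests
-- over positions are therefore traded once and for all for the inductive `AllTriples`.
¬anyTriple : ∀ w (t : ℕ → ℕ → ℕ → Bool) →
  T (not (anyTriple w (λ i j k → t (at w i) (at w j) (at w k)))) ⇔ AllTriples (λ a b c → ¬ T (t a b c)) w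
¬anyTriple w t = mk⇔ soundness completeness
  where
  n = length w
  soundness : _
  soundness h = allTriples-at⁻ w λ i j k i<j j<k k<n tijk → to (T-not _) h
    (any-upTo⁺ _ n i (ℕₚ.<-trans i<j (ℕₚ.<-trans j<k k<n))
      (any-upTo⁺ _ n j (ℕₚ.<-trans j<k k<n)
        (any-upTo⁺ _ n k k<n
          (from T-∧ (ℕₚ.<⇒<ᵇ i<j , from T-∧ (ℕₚ.<⇒<ᵇ j<k , tijk))))))
  completeness : _
  completeness h = from (T-not _) λ e →
    let i , _ , e₁ = any-upTo⁻ _ n e
        j , _ , e₂ = any-upTo⁻ _ n e₁
        k , k<n , e₃ = any-upTo⁻ _ n e₂
        i<j , e₄ = to T-∧ e₃
        j<k , e₅ = to T-∧ e₄
    in allTriples-at⁺ h i j k (ℕₚ.<ᵇ⇒< i j i<j) (ℕₚ.<ᵇ⇒< j k j<k) k<n e₅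

-- The Stirling and 132 conditions on triples of letters

Nested No132 : ℕ → ℕ → ℕ → Set
Nested a b c = a ≡ c → a < b
No132  a b c = ¬ (a < c × c < b)

nested⇔ : ∀ {w} → T (not (anyTriple w (λ i j k → (at w i ≡ᵇ at w k) ∧ not (at w i <ᵇ at w j)))) ⇔ AllTriples Nested w
nested⇔ {w} = mk⇔ (allTriples-map f ∘ to (¬anyTriple w test)) (from (¬anyTriple w test) ∘ allTriples-map g)
  where
  test : ℕ → ℕ → ℕ → Bool
  test a b c = (a ≡ᵇ c) ∧ not (a <ᵇ b)
  f : ∀ {a b c} → ¬ T (test a b c) → Nested a b c
  f {a} {b} {c} h a≡c with a ℕₚ.<? b
  ... | yes a<b = a<b
  ... | no  a≮b = contradiction (from T-∧ (ℕₚ.≡⇒≡ᵇ a c a≡c , from (T-not _) (a≮b ∘ ℕₚ.<ᵇ⇒< a b))) h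
  g : ∀ {a b c} → Nested a b c → ¬ T (test a b c)
  g {a} {b} {c} h t = let e , l = to (T-∧ {a ≡ᵇ c}) t in
    to (T-not _) l (ℕₚ.<⇒<ᵇ (h (ℕₚ.≡ᵇ⇒≡ a c e)))

no132⇔ : ∀ {w} → T (avoids132 w) ⇔ AllTriples No132 w
no132⇔ {w} = mk⇔ (allTriples-map f ∘ to (¬anyTriple w test)) (from (¬anyTriple w test) ∘ allTriples-map g)
  where
  test : ℕ → ℕ → ℕ → Bool
  test a b c = (a <ᵇ c) ∧ (c <ᵇ b)
  f : ∀ {a b c} → ¬ T (test a b c) → No132 a b c
  f h (a<c , c<b) = h (from T-∧ (ℕₚ.<⇒<ᵇ a<c , ℕₚ.<⇒<ᵇ c<b))
  g : ∀ {a b c} → No132 a b c → ¬ T (test a b c)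
  g {a} {b} {c} h t = let x , y = to (T-∧ {a <ᵇ c}) t in h (ℕₚ.<ᵇ⇒< a c x , ℕₚ.<ᵇ⇒< c b y)

Letter : ℕ → ℕ → Set
Letter n a = 1 ≤ a × a ≤ n

-- A propositional form of membership in Q132 n (see ∈-Q132⁺ and ∈-Q132⁻).
record Valid (n : ℕ) (w : List ℕ) : Set where
  field
    letters : All (Letter n) w
    twice   : ∀ k → Letter n k → count k w ≡ 2
    size    : length w ≡ 2 *ℕ n
    nested  : AllTriples Nested w
    no132   : AllTriples No132 w

open Valid

∈-allWords⁺ : ∀ {n w} → All (Letter n) w → w ∈ allWords n (length w)
∈-allWords⁺ []                          = here refl
∈-allWords⁺ {n} (_∷_ {suc a} {w} (_ , a≤n) ps) =
  ∈-concatMap⁺ _ (lose (∈-map⁺ suc (∈-upTo⁺ a≤n)) (∈-map⁺ (suc a ∷_) (∈-allWords⁺ ps)))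

∈-allWords⁻ : ∀ {n} m {w} → w ∈ allWords n m → All (Letter n) w × length w ≡ m
∈-allWords⁻ zero    (here refl) = [] , refl
∈-allWords⁻ {n} (suc m) w∈
  with find (∈-concatMap⁻ (λ a → map (a ∷_) (allWords n m)) {xs = map suc (upTo n)} w∈)
... | a , a∈ , w∈′ with ∈-map⁻ suc a∈ | ∈-map⁻ (a ∷_) w∈′
...   | b , b∈ , refl | u , u∈ , refl =
  let ps , len = ∈-allWords⁻ m u∈ in (s≤s z≤n , ∈-upTo⁻ b∈) ∷ ps , cong suc len

∈-Q132⁺ : ∀ {n w} → Valid n w → w ∈ Q132 n
∈-Q132⁺ {n} {w} V = ∈-filter⁺ (T? ∘ (λ w → isStirling n w ∧ avoids132 w))
  (subst (λ m → w ∈ allWords n m) (size V) (∈-allWords⁺ (letters V)))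
  (from T-∧ (from T-∧ (ℕₚ.≡⇒≡ᵇ _ _ (size V)
    , from T-∧ (Allₚ.all⁻ _ (All.tabulate λ {i} i∈ → ℕₚ.≡⇒≡ᵇ _ _ (twice V (suc i) (s≤s z≤n , ∈-upTo⁻ i∈)))
              , from nested⇔ (nested V)))
    , from no132⇔ (no132 V)))

∈-Q132⁻ : ∀ {n w} → w ∈ Q132 n → Valid n w
∈-Q132⁻ {n} {w} w∈ with ∈-filter⁻ (T? ∘ (λ w → isStirling n w ∧ avoids132 w)) {xs = allWords n (2 *ℕ n)} w∈
... | w∈all , t =
  let ps , len = ∈-allWords⁻ (2 *ℕ n) w∈all
      st , av  = to (T-∧ {isStirling n w}) t
      _  , st′ = to (T-∧ {length w ≡ᵇ 2 *ℕ n}) st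
      ct , ne  = to (T-∧ {all (λ i → count (suc i) w ≡ᵇ 2) (upTo n)}) st′
  in record
    { letters = ps
    ; twice   = λ { (suc i) (_ , i<n) → ℕₚ.≡ᵇ⇒≡ _ _ (All.lookup (Allₚ.all⁺ _ (upTo n) ct) (∈-upTo⁺ i<n)) }
    ; size    = len
    ; nested  = to nested⇔ ne
    ; no132   = to no132⇔ av
    }

-- An element of two blocks would have both indices as its `parent`, so the blocks are disjoint.
unique-concatMap : ∀ {A B : Set} (f : A → List B) (parent : B → A) →
  ∀ {xs} → (∀ {x y} → x ∈ xs → y ∈ f x → parent y ≡ x) → All (Unique ∘ f) xs →
  Unique xs → Unique (concatMap f xs)
unique-concatMap f parent inv us u = Uniqueₚ.concat⁺ (Allₚ.map⁺ us) (AllPairsₚ.map⁺ (disjoint inv u))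
  where
  disjoint : ∀ {xs} → (∀ {x y} → x ∈ xs → y ∈ f x → parent y ≡ x) → Unique xs →
             AllPairs (λ x y → ∀ {v} → ¬ (v ∈ f x × v ∈ f y)) xs
  disjoint inv []       = []
  disjoint inv (x∉ ∷ u) =
    All.tabulate (λ y∈ (v∈x , v∈y) → All.lookup x∉ y∈ (trans (sym (inv (here refl) v∈x)) (inv (there y∈) v∈y)))
    ∷ disjoint (inv ∘ there) u

unique-allWords : ∀ n m → Unique (allWords n m)
unique-allWords n zero    = [] ∷ []
unique-allWords n (suc m) = unique-concatMap _ (λ w → at w 0) first
  (All.tabulate λ _ → Uniqueₚ.map⁺ ∷-injectiveʳ (unique-allWords n m))
  (Uniqueₚ.map⁺ ℕₚ.suc-injective (Uniqueₚ.upTo⁺ n))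
  where
  first : ∀ {a w} → a ∈ map suc (upTo n) → w ∈ map (a ∷_) (allWords n m) → at w 0 ≡ a
  first {a} _ w∈ with _ , _ , refl ← ∈-map⁻ (a ∷_) w∈ = refl

unique-Q132 : ∀ n → Unique (Q132 n)
unique-Q132 n = Uniqueₚ.filter⁺ _ (unique-allWords n (2 *ℕ n))

-- bump j relabels a word so that the letter j becomes free; unbump j closes the gap.
bump unbump : ℕ → ℕ → ℕ
bump zero    a       = suc a
bump (suc j) zero    = zero
bump (suc j) (suc a) = suc (bump j a)
unbump zero    a       = pred a
unbump (suc j) zero    = zero
unbump (suc j) (suc a) = suc (unbump j a)

unbump-bump : ∀ j a → unbump j (bump j a) ≡ a
unbump-bump zero    a       = refl
unbump-bump (suc j) zero    = refl
unbump-bump (suc j) (suc a) = cong suc (unbump-bump j a)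

bump-unbump : ∀ j a → a ≢ j → bump j (unbump j a) ≡ a
bump-unbump zero    zero    h = contradiction refl h
bump-unbump zero    (suc a) h = refl
bump-unbump (suc j) zero    h = refl
bump-unbump (suc j) (suc a) h = cong suc (bump-unbump j a (h ∘ cong suc))

bump-≢ : ∀ j a → bump j a ≢ j
bump-≢ (suc j) (suc a) e = bump-≢ j a (ℕₚ.suc-injective e)

bump-< : ∀ {j a} → a < j → bump j a ≡ a
bump-< {suc j} {zero}  _       = refl
bump-< {suc j} {suc a} (s≤s h) = cong suc (bump-< h)

bump-≥ : ∀ {j a} → j ≤ a → bump j a ≡ suc a
bump-≥ {zero}          _       = refl
bump-≥ {suc j} {suc a} (s≤s h) = cong suc (bump-≥ h)

-- An equation of Booleans, so that it rewrites directly under `count` and the statistics, which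
-- branch on such tests.
bump-≡ᵇ : ∀ j a b → (bump j a ≡ᵇ bump j b) ≡ (a ≡ᵇ b)
bump-≡ᵇ zero    a       b       = refl
bump-≡ᵇ (suc j) zero    zero    = refl
bump-≡ᵇ (suc j) zero    (suc b) = refl
bump-≡ᵇ (suc j) (suc a) zero    = refl
bump-≡ᵇ (suc j) (suc a) (suc b) = bump-≡ᵇ j a b

bump-<ᵇ : ∀ j a b → (bump j a <ᵇ bump j b) ≡ (a <ᵇ b)
bump-<ᵇ zero    a       b       = refl
bump-<ᵇ (suc j) zero    zero    = refl
bump-<ᵇ (suc j) zero    (suc b) = refl
bump-<ᵇ (suc j) (suc a) zero    = refl
bump-<ᵇ (suc j) (suc a) (suc b) = bump-<ᵇ j a b

bump-mono : ∀ j {a b} → a < b → bump j a < bump j b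
bump-mono j {a} {b} h = ℕₚ.<ᵇ⇒< _ _ (subst T (sym (bump-<ᵇ j a b)) (ℕₚ.<⇒<ᵇ h))

bump-cancel : ∀ j {a b} → bump j a < bump j b → a < b
bump-cancel j {a} {b} h = ℕₚ.<ᵇ⇒< _ _ (subst T (bump-<ᵇ j a b) (ℕₚ.<⇒<ᵇ h))

-- Letters below `j` stay in place under `bump j`, so only letters from `j` on can land above it.
j<bump⇒j≤ : ∀ {j a} → j < bump j a → j ≤ a
j<bump⇒j≤ {j} {a} h with j ℕₚ.≤? a
... | yes j≤a = j≤a
... | no  j≰a = contradiction (subst (j <_) (bump-< (ℕₚ.≰⇒> j≰a)) h) (λ j<a → j≰a (ℕₚ.<⇒≤ j<a))

bump-injective : ∀ j {a b} → bump j a ≡ bump j b → a ≡ b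
bump-injective j {a} {b} e = trans (sym (unbump-bump j a)) (trans (cong (unbump j) e) (unbump-bump j b))

unbumps-bumps : ∀ j w → map (unbump j) (map (bump j) w) ≡ w
unbumps-bumps j w = trans (sym (map-∘ w)) (trans (map-cong-local (All.tabulate λ {a} _ → unbump-bump j a)) (map-id w))

bumps-unbumps : ∀ j {w} → All (_≢ j) w → map (bump j) (map (unbump j) w) ≡ w
bumps-unbumps j {w} ps = trans (sym (map-∘ w)) (trans (map-cong-local (All.map (bump-unbump j _) ps)) (map-id w))

letter-bump⁺ : ∀ {n j a} → Letter n a → Letter (suc n) (bump j a)
letter-bump⁺ {n} {j} {a} (1≤a , a≤n) with j ℕₚ.≤? a
... | yes j≤a rewrite bump-≥ j≤a = s≤s z≤n , s≤s a≤n
... | no  j≰a rewrite bump-< (ℕₚ.≰⇒> j≰a) = 1≤a , ℕₚ.m≤n⇒m≤1+n a≤n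

letter-bump⁻ : ∀ {n j a} → Letter (suc n) j → Letter (suc n) (bump j a) → Letter n a
letter-bump⁻ {n} {j} {a} (1≤j , j≤n) (1≤b , b≤n) with j ℕₚ.≤? a
... | yes j≤a rewrite bump-≥ j≤a = ℕₚ.≤-trans 1≤j j≤a , ℕₚ.≤-pred b≤n
... | no  j≰a rewrite bump-< (ℕₚ.≰⇒> j≰a) = 1≤b , ℕₚ.≤-pred (ℕₚ.≤-trans (ℕₚ.≰⇒> j≰a) j≤n)

-- Letter counts and triple conditions under relabelling

≡ᵇ-refl : ∀ a → (a ≡ᵇ a) ≡ true
≡ᵇ-refl zero    = refl
≡ᵇ-refl (suc a) = ≡ᵇ-refl a

≢⇒≡ᵇ-false : ∀ a b → a ≢ b → (a ≡ᵇ b) ≡ false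
≢⇒≡ᵇ-false zero    zero    h = contradiction refl h
≢⇒≡ᵇ-false zero    (suc b) h = refl
≢⇒≡ᵇ-false (suc a) zero    h = refl
≢⇒≡ᵇ-false (suc a) (suc b) h = ≢⇒≡ᵇ-false a b (h ∘ cong suc)

<⇒<ᵇ-true : ∀ {a b} → a < b → (a <ᵇ b) ≡ true
<⇒<ᵇ-true {zero}  {suc b} _       = refl
<⇒<ᵇ-true {suc a} {suc b} (s≤s h) = <⇒<ᵇ-true h

≤⇒<ᵇ-false : ∀ {a b} → a ≤ b → (b <ᵇ a) ≡ false
≤⇒<ᵇ-false {zero}  {zero}  _       = refl
≤⇒<ᵇ-false {zero}  {suc b} _       = refl
≤⇒<ᵇ-false {suc a} {suc b} (s≤s h) = ≤⇒<ᵇ-false h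

count-same : ∀ j w → count j (j ∷ w) ≡ suc (count j w)
count-same j w rewrite ≡ᵇ-refl j = refl

count-other : ∀ {a j} w → a ≢ j → count j (a ∷ w) ≡ count j w
count-other {a} {j} w h rewrite ≢⇒≡ᵇ-false a j h = refl

count-pair-same : ∀ j w → count j (j ∷ j ∷ w) ≡ suc (suc (count j w))
count-pair-same j w = trans (count-same j (j ∷ w)) (cong suc (count-same j w))

count-pair-other : ∀ {a j} w → a ≢ j → count j (a ∷ a ∷ w) ≡ count j w
count-pair-other {a} w h = trans (count-other (a ∷ w) h) (count-other w h)

count-0⁻ : ∀ j w → count j w ≡ 0 → All (_≢ j) w
count-0⁻ j []      e = []
count-0⁻ j (a ∷ w) e with a ℕₚ.≟ j
... | yes refl = contradiction (trans (sym (count-same a w)) e) λ ()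
... | no  a≢j  = a≢j ∷ count-0⁻ j w (trans (sym (count-other w a≢j)) e)

count-suc⁻ : ∀ j w {m} → count j w ≡ suc m → j ∈ w
count-suc⁻ j (a ∷ w) e with a ℕₚ.≟ j
... | yes refl = here refl
... | no  a≢j  = there (count-suc⁻ j w (trans (sym (count-other w a≢j)) e))

count-bump : ∀ j k w → count (bump j k) (map (bump j) w) ≡ count k w
count-bump j k []      = refl
count-bump j k (a ∷ w) rewrite bump-≡ᵇ j a k | count-bump j k w = refl

count-absent : ∀ j w → count j (map (bump j) w) ≡ 0
count-absent j []      = refl
count-absent j (a ∷ w) = trans (count-other (map (bump j) w) (bump-≢ j a)) (count-absent j w)

-- A letter other than `j` is the image under `bump j` of exactly one letter of order `n` and
-- inherits its count; `j` itself occurs only in the new pair.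
count-bumped-pair : ∀ {n j w} → Letter (suc n) j → (∀ k → Letter n k → count k w ≡ 2) →
                    ∀ k → Letter (suc n) k → count k (j ∷ j ∷ map (bump j) w) ≡ 2
count-bumped-pair {n} {j} {w} lj h k lk with k ℕₚ.≟ j
... | yes refl = trans (count-pair-same k (map (bump k) w)) (cong (suc ∘ suc) (count-absent k w))
... | no  k≢j  = begin
  count k (j ∷ j ∷ map (bump j) w) ≡⟨ count-pair-other (map (bump j) w) (k≢j ∘ sym) ⟩
  count k (map (bump j) w)         ≡⟨ cong (λ z → count z (map (bump j) w)) (sym k≡) ⟩
  count (bump j m) (map (bump j) w) ≡⟨ count-bump j m w ⟩
  count m w                        ≡⟨ h m (letter-bump⁻ lj (subst (Letter (suc n)) (sym k≡) lk)) ⟩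
  2 ∎
  where
  open ≡-Reasoning
  m = unbump j k
  k≡ = bump-unbump j k k≢j

nested-bump⁺ : ∀ j {w} → AllTriples Nested w → AllTriples Nested (map (bump j) w)
nested-bump⁺ j h = allTriples-map⁺ (allTriples-map (λ f e → bump-mono j (f (bump-injective j e))) h)

nested-bump⁻ : ∀ j {w} → AllTriples Nested (map (bump j) w) → AllTriples Nested w
nested-bump⁻ j h = allTriples-map (λ f e → bump-cancel j (f (cong (bump j) e))) (allTriples-map⁻ h)

no132-bump⁺ : ∀ j {w} → AllTriples No132 w → AllTriples No132 (map (bump j) w)
no132-bump⁺ j h = allTriples-map⁺ (allTriples-map (λ f (x , y) → f (bump-cancel j x , bump-cancel j y)) h)

no132-bump⁻ : ∀ j {w} → AllTriples No132 (map (bump j) w) → AllTriples No132 w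
no132-bump⁻ j h = allTriples-map (λ f (x , y) → f (bump-mono j x , bump-mono j y)) (allTriples-map⁻ h)

-- Serves both positions of the removed pair: letter counts do not see where the pair stands, and
-- the triple conditions pass to subsequences. As `j` has just two copies, none is left in `w`, so
-- `unbump j` can be undone.
delete-pair : ∀ {n j w} → Letter (suc n) j → All (Letter (suc n)) w →
  (∀ k → Letter (suc n) k → count k (j ∷ j ∷ w) ≡ 2) → length (j ∷ j ∷ w) ≡ 2 *ℕ suc n →
  AllTriples Nested w → AllTriples No132 w →
  ∃[ σ ] (Valid n σ × map (bump j) σ ≡ w)
delete-pair {n} {j} {w} lj lw h len ne av = σ , record
  { letters = All.map (letter-bump⁻ lj) (Allₚ.map⁻ (subst (All (Letter (suc n))) (sym w≡) lw))
  ; twice   = λ k lk → begin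
      count k σ                            ≡⟨ count-bump j k σ ⟨
      count (bump j k) (map (bump j) σ)    ≡⟨ cong (count (bump j k)) w≡ ⟩
      count (bump j k) w                   ≡⟨ count-pair-other w (bump-≢ j k ∘ sym) ⟨
      count (bump j k) (j ∷ j ∷ w)         ≡⟨ h (bump j k) (letter-bump⁺ lk) ⟩
      2 ∎
  ; size    = trans (length-map (unbump j) w) (ℕₚ.+-cancelˡ-≡ 2 _ _ (trans len (ℕₚ.*-suc 2 n)))
  ; nested  = nested-bump⁻ j (subst (AllTriples Nested) (sym w≡) ne)
  ; no132   = no132-bump⁻ j (subst (AllTriples No132) (sym w≡) av)
  } , w≡
  where
  open ≡-Reasoning
  σ = map (unbump j) w
  absent : count j w ≡ 0
  absent = ℕₚ.+-cancelˡ-≡ 2 _ _ (trans (sym (count-pair-same j w)) (h j lj))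
  w≡ : map (bump j) σ ≡ w
  w≡ = bumps-unbumps j (count-0⁻ j w absent)

-- The generating tree

front : ℕ → List ℕ → List ℕ
front j w = j ∷ j ∷ map (bump j) w

-- The relabelling that frees `suc h` fixes `h`, so only `t` is bumped.
second : ℕ → List ℕ → List ℕ
second h t = h ∷ suc h ∷ suc h ∷ map (bump (suc h)) t

starts-pair : List ℕ → Bool
starts-pair (a ∷ b ∷ _) = a ≡ᵇ b
starts-pair _           = false

-- A run of consecutive letters ending at the new maximum `suc n`; the powers of `v` that mark them
-- form a geometric progression.
larger-letters : ℕ → ℕ → List ℕ
larger-letters n h = map (suc h +ℕ_) (upTo (suc n ∸ h))

pair-letters : ℕ → ℕ → List ℕ → List ℕ
pair-letters n h t = if starts-pair (h ∷ t) then h ∷ larger-letters n h else larger-letters n h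

children : ℕ → List ℕ → List (List ℕ)
children n []      = [ 1 ∷ 1 ∷ [] ]
children n (h ∷ t) = second h t ∷ map (λ j → front j (h ∷ t)) (pair-letters n h t)

-- The propositional form of `pair-letters`: matching on `equal` exposes the second `h` of the
-- parent, which the Boolean test hides.
data PairLetter (n h : ℕ) : List ℕ → ℕ → Set where
  equal  : ∀ {t} → PairLetter n h (h ∷ t) h
  bigger : ∀ {t j} → h < j → j ≤ suc n → PairLetter n h t j

∈-larger-letters⁻ : ∀ {n h j} → j ∈ larger-letters n h → h < j × j ≤ suc n
∈-larger-letters⁻ {n} {h} j∈ with k , k∈ , refl ← ∈-map⁻ (suc h +ℕ_) j∈ =
  s≤s (ℕₚ.m≤m+n h k) , subst₂ _≤_ (ℕₚ.+-suc h k) (ℕₚ.m+[n∸m]≡n (ℕₚ.<⇒≤ (h<n h k∈))) (ℕₚ.+-monoʳ-≤ h (∈-upTo⁻ k∈))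
  where
  -- An inhabited range has nonzero length, so the truncated subtraction is exact.
  h<n : ∀ h {k} → k ∈ upTo (suc n ∸ h) → h < suc n
  h<n h {k} k∈ = ℕₚ.m∸n≢0⇒n<m λ e → contradiction (subst (k <_) e (∈-upTo⁻ k∈)) λ ()

∈-larger-letters⁺ : ∀ {n h j} → h < j → j ≤ suc n → j ∈ larger-letters n h
∈-larger-letters⁺ {n} {h} {j} h<j j≤n = subst (_∈ larger-letters n h) (ℕₚ.m+[n∸m]≡n h<j)
  (∈-map⁺ (suc h +ℕ_) (∈-upTo⁺ (subst (_≤ suc n ∸ h) (ℕₚ.+-∸-assoc 1 h<j) (ℕₚ.∸-monoˡ-≤ h j≤n))))

∈-pair-letters⁻ : ∀ {n h t j} → j ∈ pair-letters n h t → PairLetter n h t j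
∈-pair-letters⁻ {t = []}    j∈ = let x , y = ∈-larger-letters⁻ j∈ in bigger x y
∈-pair-letters⁻ {h = h} {t = b ∷ t} j∈ with h ℕₚ.≟ b
... | no h≢b rewrite ≢⇒≡ᵇ-false h b h≢b = let x , y = ∈-larger-letters⁻ j∈ in bigger x y
... | yes refl rewrite ≡ᵇ-refl h with j∈
...   | here refl = equal
...   | there j∈′ = let x , y = ∈-larger-letters⁻ j∈′ in bigger x y

∈-pair-letters⁺ : ∀ {n h t j} → PairLetter n h t j → j ∈ pair-letters n h t
∈-pair-letters⁺ {h = h} equal rewrite ≡ᵇ-refl h = here refl
∈-pair-letters⁺ {h = h} {t} (bigger x y) with starts-pair (h ∷ t)
... | true  = there (∈-larger-letters⁺ x y)
... | false = ∈-larger-letters⁺ x y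

unique-larger-letters : ∀ n h → Unique (larger-letters n h)
unique-larger-letters n h = Uniqueₚ.map⁺ (ℕₚ.+-cancelˡ-≡ (suc h) _ _) (Uniqueₚ.upTo⁺ _)

unique-pair-letters : ∀ n h t → Unique (pair-letters n h t)
unique-pair-letters n h t with starts-pair (h ∷ t)
... | false = unique-larger-letters n h
... | true  = All.tabulate (λ j∈ e → ℕₚ.<⇒≢ (proj₁ (∈-larger-letters⁻ j∈)) e) ∷ unique-larger-letters n h

unique-children : ∀ n σ → Unique (children n σ)
unique-children n []      = [] ∷ []
unique-children n (h ∷ t) =
  -- `second` begins with two different letters and each `front` with two equal ones; different
  -- `front` words already differ in their first letter.
  Allₚ.map⁺ (All.tabulate λ {j} _ e →
    ℕₚ.1+n≢n (trans (∷-injectiveˡ (∷-injectiveʳ e)) (sym (∷-injectiveˡ e))))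
  ∷ Uniqueₚ.map⁺ ∷-injectiveˡ (unique-pair-letters n h t)

-- A left inverse of the construction, needed to separate the children of different words. Whether
-- the first letter is doubled tells which of the two constructions to undo.
parent : List ℕ → List ℕ
parent (a ∷ b ∷ w) = if a ≡ᵇ b then map (unbump a) w else a ∷ map (unbump b) (drop1 w)
  where
  drop1 : List ℕ → List ℕ
  drop1 []      = []
  drop1 (_ ∷ w) = w
parent _ = []

parent-children : ∀ {n σ w} → w ∈ children n σ → parent w ≡ σ
parent-children {σ = []}    (here refl) = refl
parent-children {σ = h ∷ t} (here refl) rewrite ≢⇒≡ᵇ-false h (suc h) (ℕₚ.1+n≢n ∘ sym) =
  cong (h ∷_) (unbumps-bumps (suc h) t)
parent-children {n} {h ∷ t} (there w∈)
  with j , _ , refl ← ∈-map⁻ (λ j → front j (h ∷ t)) {xs = pair-letters n h t} w∈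
  rewrite ≡ᵇ-refl j = unbumps-bumps j (h ∷ t)

-- Children of valid words are valid

valid-[] : ∀ {n} → Valid n [] → n ≡ 0
valid-[] {zero}  V = refl
valid-[] {suc n} V = contradiction (size V) λ ()

pairLetter-letter : ∀ {n h t j} → Letter n h → PairLetter n h t j → Letter (suc n) j
pairLetter-letter (1≤h , h≤n) equal          = 1≤h , ℕₚ.m≤n⇒m≤1+n h≤n
pairLetter-letter (1≤h , _)   (bigger h<j j≤) = ℕₚ.≤-trans 1≤h (ℕₚ.<⇒≤ h<j) , j≤

-- A triple that begins at either new letter has its last letter in `u`, so it never returns to `j`.
nested-repeat : ∀ {j u} → All (_≢ j) u → AllTriples Nested u → AllTriples Nested (j ∷ j ∷ u)
nested-repeat {j} {u} j∉ ne = (All.map contra j∉ ∷ pairs) ∷ pairs ∷ ne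
  where
  contra : ∀ {a c} → c ≢ j → Nested j a c
  contra c≢j j≡c = contradiction (sym j≡c) c≢j
  pairs : AllPairs (Nested j) u
  pairs = AllPairs.map contra (allPairs-second j∉)

-- A triple through both new letters would need some `c` with `j < c < j`; any other triple through
-- a new letter is covered by the pair condition on `u`.
no132-repeat : ∀ {j u} → AllPairs (No132 j) u → AllTriples No132 u → AllTriples No132 (j ∷ j ∷ u)
no132-repeat ps av = (All.tabulate (λ _ (x , y) → ℕₚ.<-asym x y) ∷ ps) ∷ ps ∷ av

absent-bump : ∀ j w → All (_≢ j) (map (bump j) w)
absent-bump j w = Allₚ.map⁺ (All.tabulate λ {a} _ → bump-≢ j a)

-- Since σ avoids 132, its letters above its first letter h increase, so a new
-- first letter j ≥ h cannot play the role of 1 in the pattern.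
increasing-above : ∀ {n h t j} → Valid n (h ∷ t) → PairLetter n h t j →
                   AllPairs (No132 j) (map (bump j) (h ∷ t))
increasing-above {n} {h} {_ ∷ t} V equal with no132 V
... | (_ ∷ ps) ∷ _ = AllPairsₚ.map⁺
  (All.tabulate (λ _ → first) ∷ All.tabulate (λ _ → first)
   ∷ AllPairs.map later (AllPairs.zip (ps , allPairs-second (count-0⁻ h t absent))))
  where
  -- A relabelled letter above `h` only yields `h ≤ c`. Since no `h` remains in `t`, the inequality
  -- is strict, as the avoidance condition of the old word requires.
  absent : count h t ≡ 0
  absent = ℕₚ.+-cancelˡ-≡ 2 _ _ (trans (sym (count-pair-same h t)) (twice V h (All.head (letters V))))
  first : ∀ {c} → No132 h (bump h h) (bump h c)
  first (x , y) = ℕₚ.<⇒≱ (bump-cancel h y) (j<bump⇒j≤ x)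
  later : ∀ {b c} → No132 h b c × c ≢ h → No132 h (bump h b) (bump h c)
  later (f , c≢h) (x , y) = f (ℕₚ.≤∧≢⇒< (j<bump⇒j≤ x) (c≢h ∘ sym) , bump-cancel h y)
increasing-above {h = h} {j = j} V (bigger h<j _) with no132 V
... | ps ∷ _ = AllPairsₚ.map⁺ (All.tabulate (λ _ → first) ∷ AllPairs.map later ps)
  where
  first : ∀ {c} → No132 j (bump j h) (bump j c)
  first (x , y) = ℕₚ.<⇒≱ (bump-cancel j y) (ℕₚ.≤-trans (ℕₚ.<⇒≤ h<j) (j<bump⇒j≤ x))
  later : ∀ {b c} → No132 h b c → No132 j (bump j b) (bump j c)
  later f (x , y) = f (ℕₚ.<-≤-trans h<j (j<bump⇒j≤ x) , bump-cancel j y)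

size-pair : ∀ {n} j {w} → length w ≡ 2 *ℕ n → suc (suc (length (map (bump j) w))) ≡ 2 *ℕ suc n
size-pair {n} j {w} e = trans (cong (suc ∘ suc) (trans (length-map (bump j) w) e)) (sym (ℕₚ.*-suc 2 n))

valid-front : ∀ {n h t j} → Valid n (h ∷ t) → PairLetter n h t j → Valid (suc n) (front j (h ∷ t))
valid-front {n} {h} {t} {j} V pl = record
  { letters = lj ∷ lj ∷ Allₚ.map⁺ (All.map letter-bump⁺ (letters V))
  ; twice   = count-bumped-pair {w = h ∷ t} lj (twice V)
  ; size    = size-pair j {h ∷ t} (size V)
  ; nested  = nested-repeat (absent-bump j (h ∷ t)) (nested-bump⁺ j (nested V))
  ; no132   = no132-repeat (increasing-above V pl) (no132-bump⁺ j (no132 V))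
  }
  where
  lj = pairLetter-letter (All.head (letters V)) pl

-- Moves the pair inserted by `second` to the front, where the counts are already known.
count-swap : ∀ k a b w → count k (a ∷ b ∷ b ∷ w) ≡ count k (b ∷ b ∷ a ∷ w)
count-swap k a b w = begin
  x +ℕ (y +ℕ (y +ℕ z)) ≡⟨ +-swap x y (y +ℕ z) ⟩
  y +ℕ (x +ℕ (y +ℕ z)) ≡⟨ cong (y +ℕ_) (+-swap x y z) ⟩
  y +ℕ (y +ℕ (x +ℕ z)) ∎
  where
  open ≡-Reasoning
  x = if a ≡ᵇ k then 1 else 0
  y = if b ≡ᵇ k then 1 else 0
  z = count k w
  +-swap : ∀ x y z → x +ℕ (y +ℕ z) ≡ y +ℕ (x +ℕ z)
  +-swap x y z = trans (sym (ℕₚ.+-assoc x y z)) (trans (cong (_+ℕ z) (ℕₚ.+-comm x y)) (ℕₚ.+-assoc y x z))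

-- No letter lies strictly between `h` and `suc h`, so the inserted pair cannot be the 3 of a
-- pattern starting at `h`. If it were the 1 of a pattern, the smaller letter `h` before it could
-- take that role.
valid-second : ∀ {n h t} → Valid n (h ∷ t) → Valid (suc n) (second h t)
valid-second {n} {h} {t} V
  with letters V | nested-bump⁺ (suc h) (nested V) | no132-bump⁺ (suc h) (no132 V)
     | count-bumped-pair {w = h ∷ t} (s≤s z≤n , s≤s (proj₂ (All.head (letters V)))) (twice V)
... | lh ∷ lt | ne | av | ct rewrite bump-< (ℕₚ.n<1+n h) with ne | av
... | nh ∷ ne′ | ah ∷ av′ = record
  { letters = (proj₁ lh , ℕₚ.m≤n⇒m≤1+n (proj₂ lh)) ∷ lb ∷ lb ∷ Allₚ.map⁺ (All.map letter-bump⁺ lt)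
  ; twice   = λ k lk → trans (count-swap k h b u) (ct k lk)
  ; size    = size-pair b {h ∷ t} (size V)
  ; nested  = (((λ _ → h<b) ∷ All.tabulate (λ _ _ → h<b)) ∷ All.tabulate (λ _ _ → h<b) ∷ nh)
            ∷ nested-repeat (absent-bump b t) ne′
  ; no132   = ((between ∷ All.tabulate (λ _ → between)) ∷ All.tabulate (λ _ → between) ∷ ah)
            ∷ no132-repeat (AllPairs.map (λ f (x , y) → f (ℕₚ.<-trans h<b x , y)) ah) av′
  }
  where
  b = suc h
  u = map (bump b) t
  h<b = ℕₚ.n<1+n h
  lb : Letter (suc n) b
  lb = s≤s z≤n , s≤s (proj₂ lh)
  between : ∀ {c} → No132 h b c
  between (x , y) = ℕₚ.<⇒≱ y x

valid-11 : Valid 1 (1 ∷ 1 ∷ [])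
valid-11 = ∈-Q132⁻ (here refl)

valid-children : ∀ {n σ w} → Valid n σ → w ∈ children n σ → Valid (suc n) w
valid-children {σ = []} V (here refl) with refl ← valid-[] V = valid-11
valid-children {σ = h ∷ t} V (here refl) = valid-second V
valid-children {n} {h ∷ t} V (there w∈)
  with j , j∈ , refl ← ∈-map⁻ (λ j → front j (h ∷ t)) {xs = pair-letters n h t} w∈ =
  valid-front V (∈-pair-letters⁻ j∈)

-- The letters above a first letter a increase, hence begin with both copies of a + 1.
ascent-pair : ∀ {a c u} → AllPairs (No132 a) (c ∷ u) → AllTriples Nested (c ∷ u) → a < c →
              count (suc a) (c ∷ u) ≡ 2 → c ≡ suc a × ∃[ u′ ] (u ≡ suc a ∷ u′)
ascent-pair {a} {c} {u} (ps ∷ pss) ne a<c ct with c ℕₚ.≟ suc a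
... | no c≢ = contradiction (ℕₚ.n<1+n a , ℕₚ.≤∧≢⇒< a<c (c≢ ∘ sym))
                (All.lookup ps (count-suc⁻ (suc a) u (trans (sym (count-other u c≢)) ct)))
... | yes refl with ℕₚ.suc-injective (trans (sym (count-same c u)) ct)
...   | ct′ = refl , next u pss ne ct′
  where
  next : ∀ u → AllPairs (No132 a) u → AllTriples Nested (suc a ∷ u) → count (suc a) u ≡ 1 →
         ∃[ u′ ] (u ≡ suc a ∷ u′)
  next (d ∷ u) (ps ∷ _) ((ns ∷ _) ∷ _) ct with d ℕₚ.≟ suc a
  ... | yes refl = u , refl
  -- The other copy of `suc a` stands further on, so nesting gives `suc a < d`, and `a`, `d`,
  -- `suc a` would form the pattern 132.
  ... | no  d≢   = contradiction (ℕₚ.n<1+n a , All.lookup ns a∈ refl) (All.lookup ps a∈)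
    where a∈ = count-suc⁻ (suc a) u (trans (sym (count-other u d≢)) ct)

-- Every valid word of positive order is a child

letter-between : ∀ {n a c} → a < c → Letter n c → Letter n (suc a)
letter-between a<c (_ , c≤n) = s≤s z≤n , ℕₚ.≤-trans a<c c≤n

-- A doubled first letter `a` is deleted; if the next letter is not below `a` in the parent,
-- `ascent-pair` pins it to `a` and doubles it there. If instead the first two letters differ, the
-- second lies between the copies of `a`, so it is larger, and `ascent-pair` supplies the adjacent
-- pair to delete.
has-parent : ∀ {n w} → Valid (suc n) w → ∃[ σ ] (Valid n σ × w ∈ children n σ)
has-parent {n} {[]}        V = contradiction (size V) λ ()
has-parent {n} {_ ∷ []}    V = contradiction (trans (size V) (ℕₚ.*-suc 2 n)) λ ()
has-parent {n} {a ∷ b ∷ w} V with a ℕₚ.≟ b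
... | yes refl with V
...   | record { letters = la ∷ _ ∷ lw ; nested = _ ∷ _ ∷ ne ; no132 = _ ∷ aw ∷ av }
  with delete-pair la lw (twice V) (size V) ne av
...     | [] , Vσ , refl with refl ← valid-[] Vσ with refl ← ℕₚ.≤-antisym (proj₁ la) (proj₂ la) =
  [] , Vσ , here refl
...     | h ∷ t , Vσ , refl = h ∷ t , Vσ ,
  there (∈-map⁺ (λ j → front j (h ∷ t)) (∈-pair-letters⁺ pl))
  where
  pl : PairLetter n h t a
  pl with h ℕₚ.<? a
  ... | yes h<a = bigger h<a (proj₂ la)
  ... | no  h≮a = equal-case t (ascent-pair aw ne a<h (trans (sym (count-pair-other (map (bump a) (h ∷ t)) (ℕₚ.1+n≢n ∘ sym)))
                    (twice V (suc a) (letter-between a<h (All.head lw)))))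
    where
    bh≡ = bump-≥ (ℕₚ.≮⇒≥ h≮a)
    a<h : a < bump a h
    a<h = subst (a <_) (sym bh≡) (s≤s (ℕₚ.≮⇒≥ h≮a))
    equal-case : ∀ t → bump a h ≡ suc a × ∃[ u′ ] (map (bump a) t ≡ suc a ∷ u′) → PairLetter n h t a
    -- Under `bump a` the letter `suc a` arises only from `a`, so the parent begins with `a` twice.
    equal-case (d ∷ t) (e₁ , _ , e₂) with refl ← ℕₚ.suc-injective (trans (sym bh≡) e₁)
      with refl ← bump-injective a (trans (∷-injectiveˡ e₂) (sym (bump-≥ (ℕₚ.≤-refl {a})))) = equal
has-parent {n} {a ∷ b ∷ w} V | no a≢b with V
... | record { letters = la ∷ lb ∷ lw ; nested = (nab ∷ _) ∷ neb ; no132 = aab ∷ _ }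
  with All.lookup nab (count-suc⁻ a w a-later) refl
  where
  a-later : count a w ≡ 1
  a-later = trans (sym (count-other w (a≢b ∘ sym)))
    (ℕₚ.suc-injective (trans (sym (count-same a (b ∷ w))) (twice V a la)))
... | a<b with ascent-pair aab neb a<b (trans (sym (count-other (b ∷ w) (ℕₚ.1+n≢n ∘ sym)))
                 (twice V (suc a) (letter-between a<b lb)))
...   | refl , u , refl with V
...     | record { letters = _ ∷ _ ∷ _ ∷ lu ; nested = (_ ∷ _ ∷ na) ∷ _ ∷ _ ∷ ne ; no132 = (_ ∷ _ ∷ aa) ∷ _ ∷ _ ∷ av }
  with delete-pair {w = a ∷ u} lb (la ∷ lu) (λ k lk → trans (sym (count-swap k a b u)) (twice V k lk))
         (size V) (na ∷ ne) (aa ∷ av)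
...       | h ∷ t , Vσ , e = h ∷ t , Vσ , here (sym eq)
  where
  h<b : h < b
  -- If `b ≤ h`, relabelling would send `h` to `suc h`, which must then be `a`; but `b` is `suc a`,
  -- so `h` would lie below `b` after all.
  h<b with h ℕₚ.<? b
  ... | yes p = p
  ... | no ¬p = contradiction (trans (sym (bump-≥ (ℕₚ.≮⇒≥ ¬p))) (∷-injectiveˡ e))
                  (λ e′ → ¬p (subst (h <_) (cong suc e′) (ℕₚ.m≤n⇒m≤1+n (ℕₚ.n<1+n h))))
  h≡a : h ≡ a
  h≡a = trans (sym (bump-< h<b)) (∷-injectiveˡ e)
  eq : second h t ≡ a ∷ b ∷ b ∷ u
  eq rewrite h≡a = cong (λ z → a ∷ b ∷ b ∷ z) (∷-injectiveʳ e)

-- Two duplicate-free lists with the same members are permutations of each other, which is all that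
-- sums over them can see.
Q132-suc : ∀ n → Q132 (suc n) ↭ concatMap (children n) (Q132 n)
Q132-suc n = ∼bag⇒↭ (unique∧set⇒bag (unique-Q132 (suc n))
  (unique-concatMap (children n) parent (λ _ → parent-children) (All.tabulate λ {σ} _ → unique-children n σ) (unique-Q132 n))
  (mk⇔ split join))
  where
  split : ∀ {w} → w ∈ Q132 (suc n) → w ∈ concatMap (children n) (Q132 n)
  split w∈ = let σ , Vσ , w∈σ = has-parent (∈-Q132⁻ w∈) in
    ∈-concatMap⁺ (children n) (lose (∈-Q132⁺ Vσ) w∈σ)
  join : ∀ {w} → w ∈ concatMap (children n) (Q132 n) → w ∈ Q132 (suc n)
  join w∈ = let σ , σ∈ , w∈σ = find (∈-concatMap⁻ (children n) {xs = Q132 n} w∈) in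
    ∈-Q132⁺ (valid-children (∈-Q132⁻ σ∈) w∈σ)

-- Sums and power series

module RingLemmas {c ℓ : Level} (R : CommutativeRing c ℓ) where
  open CommutativeRing R hiding (zero) renaming (refl to ≈-refl; sym to ≈-sym; trans to ≈-trans)
  open RingProperties ring using (-‿+-comm; x[y-z]≈xy-xz; [y-z]x≈yx-zx)
  open CommutativeSemigroupProperties +-commutativeSemigroup using () renaming (interchange to +-interchange)
  open SetoidReasoning setoid

  [x+y]-[z+y]≈x-z : ∀ x y z → (x + y) - (z + y) ≈ x - z
  [x+y]-[z+y]≈x-z x y z = begin
    (x + y) + - (z + y)       ≈⟨ +-congˡ (-‿+-comm z y) ⟨
    (x + y) + (- z + - y)     ≈⟨ +-interchange x y (- z) (- y) ⟩
    (x + - z) + (y + - y)     ≈⟨ +-congˡ (-‿inverseʳ y) ⟩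
    (x + - z) + 0#            ≈⟨ +-identityʳ _ ⟩
    x + - z                   ∎

  [x-y]+[y-z]≈x-z : ∀ x y z → (x - y) + (y - z) ≈ x - z
  [x-y]+[y-z]≈x-z x y z = begin
    (x - y) + (y - z)     ≈⟨ +-assoc x (- y) (y - z) ⟩
    x + (- y + (y - z))   ≈⟨ +-congˡ (+-assoc (- y) y (- z)) ⟨
    x + ((- y + y) - z)   ≈⟨ +-congˡ (+-congʳ (-‿inverseˡ y)) ⟩
    x + (0# - z)          ≈⟨ +-congˡ (+-identityˡ (- z)) ⟩
    x - z                 ∎

  [1-b]x≈x-bx : ∀ b x → (1# - b) * x ≈ x - b * x
  [1-b]x≈x-bx b x = ≈-trans ([y-z]x≈yx-zx x 1# b) (+-congʳ (*-identityˡ x))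

  -- Eliminates `N` without inverting `1# - b`: adding `(1# - b) * L` to `(1# - b) * N ≈ a * L`
  -- leaves the factor `1# + (a - b)`.
  linear-kernel : ∀ {a b c L N} → c ≈ a - b → N ≈ a * L + b * N →
                  (1# - b) * (L + N) ≈ (1# + c) * L
  linear-kernel {a} {b} {c} {L} {N} c≈ N≈ = begin
    (1# - b) * (L + N)                          ≈⟨ [1-b]x≈x-bx b (L + N) ⟩
    (L + N) - b * (L + N)                       ≈⟨ +-cong (+-congˡ N≈) (-‿cong (distribˡ b L N)) ⟩
    (L + (a * L + b * N)) - (b * L + b * N)     ≈⟨ +-congʳ (+-assoc L (a * L) (b * N)) ⟨
    ((L + a * L) + b * N) - (b * L + b * N)     ≈⟨ [x+y]-[z+y]≈x-z (L + a * L) (b * N) (b * L) ⟩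
    (L + a * L) - b * L                         ≈⟨ +-assoc L (a * L) (- (b * L)) ⟩
    L + (a * L - b * L)                         ≈⟨ +-cong (*-identityˡ L) ([y-z]x≈yx-zx L a b) ⟨
    1# * L + (a - b) * L                        ≈⟨ +-congˡ (*-congʳ c≈) ⟨
    1# * L + c * L                              ≈⟨ distribʳ L 1# c ⟨
    (1# + c) * L                                ∎

  linear-solution : ∀ {a b c G L N} → c ≈ a - b → (1# - b) * G ≈ 1# → N ≈ a * L + b * N →
                    L + N ≈ (1# + c) * G * L
  linear-solution {a} {b} {c} {G} {L} {N} c≈ KG≈1 N≈ = begin
    L + N                          ≈⟨ *-identityˡ (L + N) ⟨
    1# * (L + N)                   ≈⟨ *-congʳ (≈-trans (≈-sym KG≈1) (*-comm (1# - b) G)) ⟩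
    G * (1# - b) * (L + N)         ≈⟨ *-assoc G (1# - b) (L + N) ⟩
    G * ((1# - b) * (L + N))       ≈⟨ *-congˡ (linear-kernel c≈ N≈) ⟩
    G * ((1# + c) * L)             ≈⟨ *-assoc G (1# + c) L ⟨
    G * (1# + c) * L               ≈⟨ *-congʳ (*-comm G (1# + c)) ⟩
    (1# + c) * G * L               ∎

  -- Multiply `(1# - b) * L ≈ P + e * (D - D′)` by `1# - b` once more; then `(1# - b) * D` can be
  -- traded for `A * L`, and `D′` alone remains unresolved.
  kernel-equation : ∀ {b e A P L D D′} → L ≈ (P + e * (D - D′)) + b * L → (1# - b) * D ≈ A * L →
    ((1# - b) * (1# - b) - e * A) * L ≈ P * (1# - b) - e * (1# - b) * D′
  kernel-equation {b} {e} {A} {P} {L} {D} {D′} L≈ KD≈ = begin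
    (K * K - e * A) * L                          ≈⟨ [y-z]x≈yx-zx L (K * K) (e * A) ⟩
    K * K * L - e * A * L                        ≈⟨ +-cong (*-assoc K K L) (-‿cong eAL≈) ⟩
    K * (K * L) - y                              ≈⟨ +-congʳ (*-congˡ KL≈) ⟩
    K * (P + e * (D - D′)) - y                   ≈⟨ +-congʳ (distribˡ K P (e * (D - D′))) ⟩
    (K * P + K * (e * (D - D′))) - y             ≈⟨ +-congʳ (+-cong (*-comm K P) (≈-sym (*-assoc K e (D - D′)))) ⟩
    (P * K + K * e * (D - D′)) - y               ≈⟨ +-congʳ (+-congˡ (*-congʳ (*-comm K e))) ⟩
    (P * K + e * K * (D - D′)) - y               ≈⟨ +-congʳ (+-congˡ (x[y-z]≈xy-xz (e * K) D D′)) ⟩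
    (P * K + (y - z)) - y                        ≈⟨ +-assoc (P * K) (y - z) (- y) ⟩
    P * K + ((y - z) - y)                        ≈⟨ +-congˡ (+-comm (y - z) (- y)) ⟩
    P * K + (- y + (y - z))                      ≈⟨ +-assoc (P * K) (- y) (y - z) ⟨
    (P * K - y) + (y - z)                        ≈⟨ [x-y]+[y-z]≈x-z (P * K) y z ⟩
    P * K - z                                    ∎
    where
    K = 1# - b
    y = e * K * D
    z = e * K * D′
    eAL≈ : e * A * L ≈ y
    eAL≈ = ≈-trans (*-assoc e A L) (≈-trans (*-congˡ (≈-sym KD≈)) (≈-sym (*-assoc e K D)))
    KL≈ : K * L ≈ P + e * (D - D′)
    KL≈ = begin
      K * L                                          ≈⟨ [1-b]x≈x-bx b L ⟩
      L - b * L                                      ≈⟨ +-congʳ L≈ ⟩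
      ((P + e * (D - D′)) + b * L) - b * L           ≈⟨ +-assoc _ (b * L) (- (b * L)) ⟩
      (P + e * (D - D′)) + (b * L - b * L)           ≈⟨ +-congˡ (-‿inverseʳ (b * L)) ⟩
      (P + e * (D - D′)) + 0#                        ≈⟨ +-identityʳ _ ⟩
      P + e * (D - D′)                               ∎

-- Finite sums over ranges and lists

module Sums {c ℓ : Level} (R : CommutativeRing c ℓ) where
  open CommutativeRing R hiding (zero) renaming (refl to ≈-refl; sym to ≈-sym; trans to ≈-trans; reflexive to ≈-reflexive)
  open RingProperties ring using (-‿+-comm; -0#≈0#)
  open RingLemmas R
  open CommutativeSemigroupProperties +-commutativeSemigroup using () renaming (interchange to +-interchange; x∙yz≈y∙xz to +-swap)
  open SetoidReasoning setoid
  open Series R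

  sumTo-cong : ∀ n {f g : ℕ → Carrier} → (∀ k → k < n → f k ≈ g k) → sumTo n f ≈ sumTo n g
  sumTo-cong zero    h = ≈-refl
  sumTo-cong (suc n) h = +-cong (sumTo-cong n (λ k k<n → h k (ℕₚ.m<n⇒m<1+n k<n))) (h n (ℕₚ.n<1+n n))

  sumTo-0 : ∀ n {f : ℕ → Carrier} → (∀ k → k < n → f k ≈ 0#) → sumTo n f ≈ 0#
  sumTo-0 zero    h = ≈-refl
  sumTo-0 (suc n) h = ≈-trans (+-cong (sumTo-0 n (λ k k<n → h k (ℕₚ.m<n⇒m<1+n k<n))) (h n (ℕₚ.n<1+n n))) (+-identityˡ 0#)

  sumTo-+ : ∀ n f g → sumTo n (λ k → f k + g k) ≈ sumTo n f + sumTo n g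
  sumTo-+ zero    f g = ≈-sym (+-identityˡ 0#)
  sumTo-+ (suc n) f g = ≈-trans (+-congʳ (sumTo-+ n f g)) (+-interchange _ _ _ _)

  sumTo-*ˡ : ∀ n a f → sumTo n (λ k → a * f k) ≈ a * sumTo n f
  sumTo-*ˡ zero    a f = ≈-sym (zeroʳ a)
  sumTo-*ˡ (suc n) a f = ≈-trans (+-congʳ (sumTo-*ˡ n a f)) (≈-sym (distribˡ a _ _))

  sumTo-head : ∀ n f → sumTo (suc n) f ≈ f 0 + sumTo n (λ k → f (suc k))
  sumTo-head zero    f = +-comm 0# (f 0)
  sumTo-head (suc n) f = ≈-trans (+-congʳ (sumTo-head n f)) (+-assoc _ _ _)

  sumTo-single : ∀ n i {f : ℕ → Carrier} → i < n → (∀ k → k ≢ i → f k ≈ 0#) → sumTo n f ≈ f i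
  sumTo-single (suc n) i {f} i<n h with i ℕₚ.≟ n
  ... | yes refl = ≈-trans (+-congʳ (sumTo-0 n (λ k k<n → h k (ℕₚ.<⇒≢ k<n)))) (+-identityˡ (f n))
  ... | no  i≢n  = ≈-trans (+-cong (sumTo-single n i (ℕₚ.≤∧≢⇒< (ℕₚ.≤-pred i<n) i≢n) h) (h n (i≢n ∘ sym))) (+-identityʳ (f i))

  module _ {A : Set} where

    ∑ : (A → Carrier) → List A → Carrier
    ∑ f xs = sumList (map f xs)

    ∑-cong : ∀ {f g : A → Carrier} {xs} → All (λ x → f x ≈ g x) xs → ∑ f xs ≈ ∑ g xs
    ∑-cong []       = ≈-refl
    ∑-cong (e ∷ es) = +-cong e (∑-cong es)

    ∑-0 : ∀ xs → ∑ (λ _ → 0#) xs ≈ 0#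
    ∑-0 []       = ≈-refl
    ∑-0 (x ∷ xs) = ≈-trans (+-identityˡ _) (∑-0 xs)

    ∑-+ : ∀ f g xs → ∑ (λ x → f x + g x) xs ≈ ∑ f xs + ∑ g xs
    ∑-+ f g []       = ≈-sym (+-identityˡ 0#)
    ∑-+ f g (x ∷ xs) = ≈-trans (+-congˡ (∑-+ f g xs)) (+-interchange _ _ _ _)

    ∑-neg : ∀ f xs → ∑ (λ x → - f x) xs ≈ - ∑ f xs
    ∑-neg f []       = ≈-sym -0#≈0#
    ∑-neg f (x ∷ xs) = ≈-trans (+-congˡ (∑-neg f xs)) (-‿+-comm _ _)

    ∑-*ˡ : ∀ a f xs → ∑ (λ x → a * f x) xs ≈ a * ∑ f xs
    ∑-*ˡ a f []       = ≈-sym (zeroʳ a)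
    ∑-*ˡ a f (x ∷ xs) = ≈-trans (+-congˡ (∑-*ˡ a f xs)) (≈-sym (distribˡ a _ _))

    ∑-*ʳ : ∀ a f xs → ∑ f xs * a ≈ ∑ (λ x → f x * a) xs
    ∑-*ʳ a f []       = zeroˡ a
    ∑-*ʳ a f (x ∷ xs) = ≈-trans (distribʳ a _ _) (+-congˡ (∑-*ʳ a f xs))

    ∑-↭ : ∀ f {xs ys} → xs ↭ ys → ∑ f xs ≈ ∑ f ys
    ∑-↭ f _↭_.refl           = ≈-refl
    ∑-↭ f (_↭_.prep x σ)     = +-congˡ (∑-↭ f σ)
    ∑-↭ f (_↭_.swap x y σ)   = ≈-trans (+-swap _ _ _) (+-congˡ (+-congˡ (∑-↭ f σ)))
    ∑-↭ f (_↭_.trans σ τ)    = ≈-trans (∑-↭ f σ) (∑-↭ f τ)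

    ∑-++ : ∀ f xs ys → ∑ f (xs ++ ys) ≈ ∑ f xs + ∑ f ys
    ∑-++ f []       ys = ≈-sym (+-identityˡ _)
    ∑-++ f (x ∷ xs) ys = ≈-trans (+-congˡ (∑-++ f xs ys)) (≈-sym (+-assoc _ _ _))

    ∑-filter : ∀ f (t : A → Bool) xs → ∑ f (filterᵇ t xs) ≈ ∑ (λ x → if t x then f x else 0#) xs
    ∑-filter f t []       = ≈-refl
    ∑-filter f t (x ∷ xs) with t x
    ... | true  = +-congˡ (∑-filter f t xs)
    ... | false = ≈-trans (∑-filter f t xs) (≈-sym (+-identityˡ _))

    sumTo-∑ : ∀ n (f : ℕ → A → Carrier) xs → sumTo n (λ k → ∑ (f k) xs) ≈ ∑ (λ x → sumTo n (λ k → f k x)) xs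
    sumTo-∑ n f []       = sumTo-0 n (λ _ _ → ≈-refl)
    sumTo-∑ n f (x ∷ xs) = ≈-trans (sumTo-+ n _ _) (+-congˡ (sumTo-∑ n f xs))

  ∑-concatMap : ∀ {A B : Set} f (g : A → List B) xs → ∑ f (concatMap g xs) ≈ ∑ (λ x → ∑ f (g x)) xs
  ∑-concatMap f g []       = ≈-refl
  ∑-concatMap f g (x ∷ xs) = ≈-trans (∑-++ f (g x) (concatMap g xs)) (+-congˡ (∑-concatMap f g xs))

  -- Telescoping. The sequence may start at any power of `v`, as the sums over larger letters do.
  geometric-sum : ∀ v m (f : ℕ → Carrier) → (∀ k → f (suc k) ≈ v * f k) →
                  (1# - v) * sumList (applyUpTo f m) ≈ f 0 - f m
  geometric-sum v zero    f h = ≈-trans (zeroʳ _) (≈-sym (-‿inverseʳ (f 0)))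
  geometric-sum v (suc m) f h = begin
    (1# - v) * (f 0 + sumList (applyUpTo (f ∘ suc) m))                ≈⟨ distribˡ _ _ _ ⟩
    (1# - v) * f 0 + (1# - v) * sumList (applyUpTo (f ∘ suc) m)       ≈⟨ +-cong ([1-b]x≈x-bx v (f 0)) (geometric-sum v m (f ∘ suc) (h ∘ suc)) ⟩
    (f 0 - v * f 0) + (f 1 - f (suc m))                               ≈⟨ +-congʳ (+-congˡ (-‿cong (h 0))) ⟨
    (f 0 - f 1) + (f 1 - f (suc m))                                   ≈⟨ [x-y]+[y-z]≈x-z _ _ _ ⟩
    f 0 - f (suc m)                                                   ∎

  pow-1 : ∀ k → pow 1# k ≈ 1#
  pow-1 zero    = ≈-refl
  pow-1 (suc k) = ≈-trans (*-identityˡ _) (pow-1 k)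

-- The ring of formal power series

module PowerSeries {c ℓ : Level} (R : CommutativeRing c ℓ) where
  open CommutativeRing R hiding (zero) renaming (refl to ≈-refl; sym to ≈-sym; trans to ≈-trans; reflexive to ≈-reflexive)
  open Series R
  open Sums R
  open SetoidReasoning setoid

  tail : PS → PS
  tail f n = f (suc n)

  ⊗-cong : ∀ {f f′ g g′} → f ≋ f′ → g ≋ g′ → f ⊗ g ≋ f′ ⊗ g′
  ⊗-cong f≋ g≋ n = sumTo-cong (suc n) (λ k _ → *-cong (f≋ k) (g≋ (n ∸ k)))

  ⊗-zero : ∀ f g → (f ⊗ g) 0 ≈ f 0 * g 0
  ⊗-zero f g = +-identityˡ _

  ⊗-suc : ∀ f g n → (f ⊗ g) (suc n) ≈ f 0 * g (suc n) + (tail f ⊗ g) n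
  ⊗-suc f g n = sumTo-head (suc n) _

  ⊗-sucʳ : ∀ f g n → (f ⊗ g) (suc n) ≈ (f ⊗ tail g) n + f (suc n) * g 0
  ⊗-sucʳ f g n = +-cong
    (sumTo-cong (suc n) (λ k k<n → *-congˡ (≈-reflexive (cong g (ℕₚ.+-∸-assoc 1 (ℕₚ.≤-pred k<n))))))
    (*-congˡ (≈-reflexive (cong g (ℕₚ.n∸n≡0 n))))

  -- Splitting off the first term of one convolution and the last term of the other leaves
  -- convolutions of lower index.
  ⊗-comm : ∀ f g → f ⊗ g ≋ g ⊗ f
  ⊗-comm f g zero    = ≈-trans (⊗-zero f g) (≈-trans (*-comm _ _) (≈-sym (⊗-zero g f)))
  ⊗-comm f g (suc n) = begin
    (f ⊗ g) (suc n)                       ≈⟨ ⊗-suc f g n ⟩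
    f 0 * g (suc n) + (tail f ⊗ g) n      ≈⟨ +-cong (*-comm _ _) (⊗-comm (tail f) g n) ⟩
    g (suc n) * f 0 + (g ⊗ tail f) n      ≈⟨ +-comm _ _ ⟩
    (g ⊗ tail f) n + g (suc n) * f 0      ≈⟨ ⊗-sucʳ g f n ⟨
    (g ⊗ f) (suc n)                       ∎

  ⊗-distribʳ : ∀ h f g → (f ⊕ g) ⊗ h ≋ f ⊗ h ⊕ g ⊗ h
  ⊗-distribʳ h f g n = ≈-trans (sumTo-cong (suc n) (λ k _ → distribʳ _ _ _)) (sumTo-+ (suc n) _ _)

  ⊗-distribˡ : ∀ h f g → h ⊗ (f ⊕ g) ≋ h ⊗ f ⊕ h ⊗ g
  ⊗-distribˡ h f g n = ≈-trans (sumTo-cong (suc n) (λ k _ → distribˡ _ _ _)) (sumTo-+ (suc n) _ _)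

  ⊗-scale : ∀ a f g n → ((λ k → a * f k) ⊗ g) n ≈ a * (f ⊗ g) n
  ⊗-scale a f g n = ≈-trans (sumTo-cong (suc n) (λ k _ → *-assoc _ _ _)) (sumTo-*ˡ (suc n) a _)

  -- Induction on the index: the first coefficient of `f` contributes a scalar multiple of `g ⊗ h`,
  -- and the rest is the same claim for `tail f`.
  ⊗-assoc : ∀ f g h → (f ⊗ g) ⊗ h ≋ f ⊗ (g ⊗ h)
  ⊗-assoc f g h zero = begin
    ((f ⊗ g) ⊗ h) 0      ≈⟨ ⊗-zero (f ⊗ g) h ⟩
    (f ⊗ g) 0 * h 0      ≈⟨ *-congʳ (⊗-zero f g) ⟩
    f 0 * g 0 * h 0      ≈⟨ *-assoc _ _ _ ⟩
    f 0 * (g 0 * h 0)    ≈⟨ *-congˡ (⊗-zero g h) ⟨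
    f 0 * (g ⊗ h) 0      ≈⟨ ⊗-zero f (g ⊗ h) ⟨
    (f ⊗ (g ⊗ h)) 0      ∎
  ⊗-assoc f g h (suc n) = begin
    ((f ⊗ g) ⊗ h) (suc n)
      ≈⟨ ⊗-suc (f ⊗ g) h n ⟩
    (f ⊗ g) 0 * h (suc n) + (tail (f ⊗ g) ⊗ h) n
      ≈⟨ +-cong (≈-trans (*-congʳ (⊗-zero f g)) (*-assoc _ _ _)) (⊗-cong {g = h} {h} (⊗-suc f g) (λ _ → ≈-refl) n) ⟩
    f 0 * (g 0 * h (suc n)) + (((λ k → f 0 * g (suc k)) ⊕ (tail f ⊗ g)) ⊗ h) n
      ≈⟨ +-congˡ (⊗-distribʳ h _ _ n) ⟩
    f 0 * (g 0 * h (suc n)) + (((λ k → f 0 * g (suc k)) ⊗ h) n + ((tail f ⊗ g) ⊗ h) n)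
      ≈⟨ +-congˡ (+-cong (⊗-scale (f 0) (tail g) h n) (⊗-assoc (tail f) g h n)) ⟩
    f 0 * (g 0 * h (suc n)) + (f 0 * (tail g ⊗ h) n + (tail f ⊗ (g ⊗ h)) n)
      ≈⟨ +-assoc _ _ _ ⟨
    f 0 * (g 0 * h (suc n)) + f 0 * (tail g ⊗ h) n + (tail f ⊗ (g ⊗ h)) n
      ≈⟨ +-congʳ (distribˡ _ _ _) ⟨
    f 0 * (g 0 * h (suc n) + (tail g ⊗ h) n) + (tail f ⊗ (g ⊗ h)) n
      ≈⟨ +-congʳ (*-congˡ (⊗-suc g h n)) ⟨
    f 0 * (g ⊗ h) (suc n) + (tail f ⊗ (g ⊗ h)) n
      ≈⟨ ⊗-suc f (g ⊗ h) n ⟨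
    (f ⊗ (g ⊗ h)) (suc n) ∎

  ⟨⟩-⊗ : ∀ a f n → (⟨ a ⟩ ⊗ f) n ≈ a * f n
  ⟨⟩-⊗ a f zero    = ⊗-zero ⟨ a ⟩ f
  ⟨⟩-⊗ a f (suc n) = ≈-trans (⊗-suc ⟨ a ⟩ f n)
    (≈-trans (+-congˡ (sumTo-0 (suc n) (λ _ _ → zeroˡ _))) (+-identityʳ _))

  X-zero : ∀ f → (X ⊗ f) 0 ≈ 0#
  X-zero f = ≈-trans (⊗-zero X f) (zeroˡ _)

  X-suc : ∀ f n → (X ⊗ f) (suc n) ≈ f n
  X-suc f n = begin
    (X ⊗ f) (suc n)                   ≈⟨ ⊗-suc X f n ⟩
    0# * f (suc n) + (tail X ⊗ f) n   ≈⟨ +-cong (zeroˡ _) (⊗-cong {g = f} {f} tailX (λ _ → ≈-refl) n) ⟩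
    0# + (⟨ 1# ⟩ ⊗ f) n               ≈⟨ +-identityˡ _ ⟩
    (⟨ 1# ⟩ ⊗ f) n                    ≈⟨ ⟨⟩-⊗ 1# f n ⟩
    1# * f n                          ≈⟨ *-identityˡ _ ⟩
    f n                               ∎
    where
    tailX : tail X ≋ ⟨ 1# ⟩
    tailX zero    = ≈-refl
    tailX (suc _) = ≈-refl

  aX-zero : ∀ a f → (⟨ a ⟩ ⊗ X ⊗ f) 0 ≈ 0#
  aX-zero a f = ≈-trans (⊗-assoc ⟨ a ⟩ X f 0) (≈-trans (⟨⟩-⊗ a (X ⊗ f) 0) (≈-trans (*-congˡ (X-zero f)) (zeroʳ a)))

  aX-suc : ∀ a f n → (⟨ a ⟩ ⊗ X ⊗ f) (suc n) ≈ a * f n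
  aX-suc a f n = ≈-trans (⊗-assoc ⟨ a ⟩ X f (suc n)) (≈-trans (⟨⟩-⊗ a (X ⊗ f) (suc n)) (*-congˡ (X-suc f n)))

  ⊗-identityˡ : ∀ f → ⟨ 1# ⟩ ⊗ f ≋ f
  ⊗-identityˡ f n = ≈-trans (⟨⟩-⊗ 1# f n) (*-identityˡ _)

  -- Lets the elimination identities of `RingLemmas` be applied to series.
  seriesRing : CommutativeRing c ℓ
  seriesRing = record
    { Carrier = PS ; _≈_ = _≋_ ; _+_ = _⊕_ ; _*_ = _⊗_ ; -_ = λ f n → - f n
    ; 0# = λ _ → 0# ; 1# = ⟨ 1# ⟩
    ; isCommutativeRing = record
      { isRing = record
        { +-isAbelianGroup = record
          { isGroup = record
            { isMonoid = record
              { isSemigroup = record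
                { isMagma = record
                  { isEquivalence = record
                    { refl  = λ _ → ≈-refl
                    ; sym   = λ e n → ≈-sym (e n)
                    ; trans = λ e e′ n → ≈-trans (e n) (e′ n)
                    }
                  ; ∙-cong = λ e e′ n → +-cong (e n) (e′ n)
                  }
                ; assoc = λ f g h n → +-assoc (f n) (g n) (h n)
                }
              ; identity = (λ f n → +-identityˡ (f n)) , (λ f n → +-identityʳ (f n))
              }
            ; inverse = (λ f n → -‿inverseˡ (f n)) , (λ f n → -‿inverseʳ (f n))
            ; ⁻¹-cong = λ e n → -‿cong (e n)
            }
          ; comm = λ f g n → +-comm (f n) (g n)
          }
        ; *-cong = ⊗-cong
        ; *-assoc = ⊗-assoc
        ; *-identity = ⊗-identityˡ , (λ f n → ≈-trans (⊗-comm f ⟨ 1# ⟩ n) (⊗-identityˡ f n))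
        ; distrib = ⊗-distribˡ , ⊗-distribʳ
        }
      ; *-comm = ⊗-comm
      }
    }

  geom-inverse : ∀ a → (⟨ 1# ⟩ ⊖ ⟨ a ⟩ ⊗ X) ⊗ geom a ≋ ⟨ 1# ⟩
  geom-inverse a n = ≈-trans (RingLemmas.[1-b]x≈x-bx seriesRing (⟨ a ⟩ ⊗ X) (geom a) n) (coefficient n)
    where
    coefficient : ∀ n → geom a n - (⟨ a ⟩ ⊗ X ⊗ geom a) n ≈ ⟨ 1# ⟩ n
    coefficient zero    = ≈-trans (+-congˡ (≈-trans (-‿cong (aX-zero a (geom a))) -0#≈0#)) (+-identityʳ 1#)
      where open RingProperties ring using (-0#≈0#)
    coefficient (suc n) = ≈-trans (+-congˡ (-‿cong (aX-suc a (geom a) n))) (-‿inverseʳ _)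

-- Recurrences for the weighted counts

plat-bump : ∀ j w → plat (map (bump j) w) ≡ plat w
plat-bump j []          = refl
plat-bump j (a ∷ [])    = refl
plat-bump j (a ∷ b ∷ w) = cong₂ (λ t k → (if t then 1 else 0) +ℕ k) (bump-≡ᵇ j a b) (plat-bump j (b ∷ w))

des-bump : ∀ j w → des (map (bump j) w) ≡ des w
des-bump j []          = refl
des-bump j (a ∷ [])    = refl
des-bump j (a ∷ b ∷ w) = cong₂ (λ t k → (if t then 1 else 0) +ℕ k) (bump-<ᵇ j b a) (des-bump j (b ∷ w))

asc-bump : ∀ j w → asc (map (bump j) w) ≡ asc w
asc-bump j []          = refl
asc-bump j (a ∷ [])    = refl
asc-bump j (a ∷ b ∷ w) = cong₂ (λ t k → (if t then 1 else 0) +ℕ k) (bump-<ᵇ j a b) (asc-bump j (b ∷ w))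

-- The other copy of `h` stands further on, so `a` lies between the two copies.
second-ascends : ∀ {n h a t} → Valid n (h ∷ a ∷ t) → h ≢ a → h < a
second-ascends {n} {h} {a} {t} V h≢a with nested V
... | (ns ∷ _) ∷ _ = All.lookup ns (count-suc⁻ h t later) refl
  where
  later : count h t ≡ 1
  later = trans (sym (count-other t (h≢a ∘ sym)))
    (ℕₚ.suc-injective (trans (sym (count-same h (a ∷ t))) (twice V h (All.head (letters V)))))

starts-pair-front : ∀ j w → starts-pair (front j w) ≡ true
starts-pair-front j w = ≡ᵇ-refl j

starts-pair-second : ∀ h t → starts-pair (second h t) ≡ false
starts-pair-second h t = ≢⇒≡ᵇ-false h (suc h) (ℕₚ.1+n≢n ∘ sym)

module Recurrences {c ℓ : Level} (R : CommutativeRing c ℓ) (p q r : CommutativeRing.Carrier R) where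
  open CommutativeRing R hiding (zero) renaming (refl to ≈-refl; sym to ≈-sym; trans to ≈-trans; reflexive to ≈-reflexive)
  open Series R
  open Stirling p q r
  open Sums R
  open PowerSeries R
  open RingProperties ring using (x[y-z]≈xy-xz; [y-z]x≈yx-zx)
  open SetoidReasoning setoid
  module S = SemiringSolver commutativeSemiring
  open S using (_:*_; _:+_; _:=_)

  -- Weights of children

  weight-plateau : ∀ a w → weight (a ∷ a ∷ w) ≈ p * weight (a ∷ w)
  weight-plateau a w rewrite ≡ᵇ-refl a | ≤⇒<ᵇ-false (ℕₚ.≤-refl {a}) =
    S.solve 4 (λ p x y z → (p :* x) :* y :* z := p :* (x :* y :* z)) ≈-refl p _ _ _

  weight-descent : ∀ {a b} w → b < a → weight (a ∷ b ∷ w) ≈ q * weight (b ∷ w)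
  weight-descent {a} {b} w b<a
    rewrite ≢⇒≡ᵇ-false a b (ℕₚ.>⇒≢ b<a) | <⇒<ᵇ-true b<a | ≤⇒<ᵇ-false (ℕₚ.<⇒≤ b<a) =
    S.solve 4 (λ q x y z → x :* (q :* y) :* z := q :* (x :* y :* z)) ≈-refl q _ _ _

  weight-ascent : ∀ {a b} w → a < b → weight (a ∷ b ∷ w) ≈ r * weight (b ∷ w)
  weight-ascent {a} {b} w a<b
    rewrite ≢⇒≡ᵇ-false a b (ℕₚ.<⇒≢ a<b) | <⇒<ᵇ-true a<b | ≤⇒<ᵇ-false (ℕₚ.<⇒≤ a<b) =
    S.solve 4 (λ r x y z → x :* y :* (r :* z) := r :* (x :* y :* z)) ≈-refl r _ _ _

  weight-bump : ∀ j w → weight (map (bump j) w) ≡ weight w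
  weight-bump j w rewrite plat-bump j w | des-bump j w | asc-bump j w = refl

  weight-front-bigger : ∀ {h j} t → h < j → weight (front j (h ∷ t)) ≈ p * q * weight (h ∷ t)
  weight-front-bigger {h} {j} t h<j = begin
    weight (front j (h ∷ t))                  ≈⟨ weight-plateau j (map (bump j) (h ∷ t)) ⟩
    p * weight (j ∷ map (bump j) (h ∷ t))     ≈⟨ *-congˡ (weight-descent (map (bump j) t) (subst (_< j) (sym (bump-< h<j)) h<j)) ⟩
    p * (q * weight (map (bump j) (h ∷ t)))   ≈⟨ *-assoc _ _ _ ⟨
    p * q * weight (map (bump j) (h ∷ t))     ≡⟨ cong (p * q *_) (weight-bump j (h ∷ t)) ⟩
    p * q * weight (h ∷ t)                    ∎

  -- The old `h` is relabelled `suc h`, so an ascent follows the prepended pair, in contrast to the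
  -- descent for larger letters.
  weight-front-equal : ∀ h t → weight (front h (h ∷ t)) ≈ p * r * weight (h ∷ t)
  weight-front-equal h t = begin
    weight (front h (h ∷ t))                  ≈⟨ weight-plateau h (map (bump h) (h ∷ t)) ⟩
    p * weight (h ∷ map (bump h) (h ∷ t))     ≈⟨ *-congˡ (weight-ascent (map (bump h) t) (subst (h <_) (sym (bump-≥ (ℕₚ.≤-refl {h}))) (ℕₚ.n<1+n h))) ⟩
    p * (r * weight (map (bump h) (h ∷ t)))   ≈⟨ *-assoc _ _ _ ⟨
    p * r * weight (map (bump h) (h ∷ t))     ≡⟨ cong (p * r *_) (weight-bump h (h ∷ t)) ⟩
    p * r * weight (h ∷ t)                    ∎

  -- The insertion breaks the plateau `h h` into an ascent, a plateau and a descent, so `p` is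
  -- traded for `r * p * q`.
  weight-second-pair : ∀ h t → weight (second h (h ∷ t)) ≈ q * r * weight (h ∷ h ∷ t)
  weight-second-pair h t = begin
    weight (second h (h ∷ t))
      ≈⟨ weight-ascent (b ∷ map (bump b) (h ∷ t)) (ℕₚ.n<1+n h) ⟩
    r * weight (b ∷ b ∷ map (bump b) (h ∷ t))
      ≈⟨ *-congˡ (weight-plateau b (map (bump b) (h ∷ t))) ⟩
    r * (p * weight (b ∷ map (bump b) (h ∷ t)))
      ≈⟨ *-congˡ (*-congˡ (weight-descent (map (bump b) t) (subst (_< b) (sym (bump-< (ℕₚ.n<1+n h))) (ℕₚ.n<1+n h)))) ⟩
    r * (p * (q * weight (map (bump b) (h ∷ t))))
      ≡⟨ cong (λ z → r * (p * (q * z))) (weight-bump b (h ∷ t)) ⟩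
    r * (p * (q * weight (h ∷ t)))
      ≈⟨ S.solve 4 (λ p q r x → r :* (p :* (q :* x)) := q :* r :* (p :* x)) ≈-refl p q r _ ⟩
    q * r * (p * weight (h ∷ t))
      ≈⟨ *-congˡ (weight-plateau h t) ⟨
    q * r * weight (h ∷ h ∷ t) ∎
    where b = suc h

  -- Relabelling lifts `a` above the inserted pair, so one ascent becomes an ascent, a plateau and
  -- an ascent.
  weight-second-ascent : ∀ {h a} t → h < a → weight (second h (a ∷ t)) ≈ p * r * weight (h ∷ a ∷ t)
  weight-second-ascent {h} {a} t h<a = begin
    weight (second h (a ∷ t))
      ≈⟨ weight-ascent (b ∷ map (bump b) (a ∷ t)) (ℕₚ.n<1+n h) ⟩
    r * weight (b ∷ b ∷ map (bump b) (a ∷ t))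
      ≈⟨ *-congˡ (weight-plateau b (map (bump b) (a ∷ t))) ⟩
    r * (p * weight (b ∷ map (bump b) (a ∷ t)))
      ≈⟨ *-congˡ (*-congˡ (weight-ascent (map (bump b) t) (subst (b <_) (sym (bump-≥ h<a)) (s≤s h<a)))) ⟩
    r * (p * (r * weight (map (bump b) (a ∷ t))))
      ≡⟨ cong (λ z → r * (p * (r * z))) (weight-bump b (a ∷ t)) ⟩
    r * (p * (r * weight (a ∷ t)))
      ≈⟨ S.solve 3 (λ p r x → r :* (p :* (r :* x)) := p :* r :* (r :* x)) ≈-refl p r _ ⟩
    p * r * (r * weight (a ∷ t))
      ≈⟨ *-congˡ (weight-ascent t h<a) ⟨
    p * r * weight (h ∷ a ∷ t) ∎
    where b = suc h

  -- The summands of the series L and N of the overview, extended by zero so that both sums run over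
  -- the same list of words.
  placed pairW soloW : Carrier → List ℕ → Carrier
  placed v w = weight w * pow v (pred (at w 0))
  pairW  v w = if starts-pair w then placed v w else 0#
  soloW  v w = if starts-pair w then 0# else placed v w

  pair+solo : ∀ v w → pairW v w + soloW v w ≈ placed v w
  pair+solo v w with starts-pair w
  ... | true  = +-identityʳ _
  ... | false = +-identityˡ _

  ∑Q132-suc : ∀ n f → ∑ f (Q132 (suc n)) ≈ ∑ (λ σ → ∑ f (children n σ)) (Q132 n)
  ∑Q132-suc n f = ≈-trans (∑-↭ f (Q132-suc n)) (∑-concatMap f (children n) (Q132 n))

  pairW-true : ∀ v w → starts-pair w ≡ true → pairW v w ≡ placed v w
  pairW-true v w e rewrite e = refl

  pairW-false : ∀ v w → starts-pair w ≡ false → pairW v w ≡ 0#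
  pairW-false v w e rewrite e = refl

  soloW-true : ∀ v w → starts-pair w ≡ true → soloW v w ≡ 0#
  soloW-true v w e rewrite e = refl

  soloW-false : ∀ v w → starts-pair w ≡ false → soloW v w ≡ placed v w
  soloW-false v w e rewrite e = refl

  -- Only the child made by `second` starts with two different letters, and it keeps the first
  -- letter and hence the power of `v`.
  soloW-children : ∀ v {n σ} → Valid (suc n) σ →
                   ∑ (soloW v) (children (suc n) σ) ≈ q * r * pairW v σ + p * r * soloW v σ
  soloW-children v {n} {[]}    V = contradiction (valid-[] V) λ ()
  soloW-children v {n} {h ∷ []} V = contradiction (trans (size V) (ℕₚ.*-suc 2 n)) λ ()
  soloW-children v {n} {h ∷ a ∷ t} V = begin
    soloW v (second h (a ∷ t)) + ∑ (soloW v) (map (λ j → front j σ) js)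
      ≈⟨ +-cong (≈-reflexive (soloW-false v (second h (a ∷ t)) (starts-pair-second h (a ∷ t)))) fronts ⟩
    placed v (second h (a ∷ t)) + 0#
      ≈⟨ +-identityʳ _ ⟩
    placed v (second h (a ∷ t))
      ≈⟨ cases ⟩
    q * r * pairW v σ + p * r * soloW v σ ∎
    where
    σ = h ∷ a ∷ t
    js = pair-letters (suc n) h (a ∷ t)
    fronts : ∑ (soloW v) (map (λ j → front j σ) js) ≈ 0#
    fronts = ≈-trans (≈-reflexive (cong sumList (sym (map-∘ js))))
      (≈-trans (∑-cong {xs = js} (All.tabulate λ {j} _ → ≈-reflexive (soloW-true v (front j σ) (starts-pair-front j σ)))) (∑-0 js))
    cases : placed v (second h (a ∷ t)) ≈ q * r * pairW v σ + p * r * soloW v σ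
    cases with h ℕₚ.≟ a
    ... | yes refl = begin
      weight (second h (h ∷ t)) * x              ≈⟨ *-congʳ (weight-second-pair h t) ⟩
      q * r * weight σ * x                       ≈⟨ *-assoc _ _ _ ⟩
      q * r * placed v σ                         ≈⟨ +-identityʳ _ ⟨
      q * r * placed v σ + 0#                    ≈⟨ +-congˡ (zeroʳ _) ⟨
      q * r * placed v σ + p * r * 0#            ≡⟨ cong₂ (λ y z → q * r * y + p * r * z) (pairW-true v σ (≡ᵇ-refl h)) (soloW-true v σ (≡ᵇ-refl h)) ⟨
      q * r * pairW v σ + p * r * soloW v σ      ∎
      where x = pow v (pred h)
    ... | no h≢a = begin
      weight (second h (a ∷ t)) * x              ≈⟨ *-congʳ (weight-second-ascent t (second-ascends V h≢a)) ⟩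
      p * r * weight σ * x                       ≈⟨ *-assoc _ _ _ ⟩
      p * r * placed v σ                         ≈⟨ +-identityˡ _ ⟨
      0# + p * r * placed v σ                    ≈⟨ +-congʳ (zeroʳ _) ⟨
      q * r * 0# + p * r * placed v σ            ≡⟨ cong₂ (λ y z → q * r * y + p * r * z) (pairW-false v σ h≡ᵇa) (soloW-false v σ h≡ᵇa) ⟨
      q * r * pairW v σ + p * r * soloW v σ      ∎
      where
      x = pow v (pred h)
      h≡ᵇa = ≢⇒≡ᵇ-false h a h≢a

  module _ (v w : Carrier) (w-inverse : (1# - v) * w ≈ 1#) where

    -- The exponents run from `h` to `n`, and `w` stands for 1/(1 - v).
    larger-letters-sum : ∀ {n h} → h ≤ suc n →
      ∑ (λ j → pow v (pred j)) (larger-letters n h) ≈ w * (pow v h - pow v (suc n))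
    larger-letters-sum {n} {h} h≤ = begin
      ∑ (λ j → pow v (pred j)) (larger-letters n h)
        ≡⟨ cong sumList (trans (sym (map-∘ (upTo m))) (map-applyUpTo (λ k → k) f m)) ⟩
      s                             ≈⟨ *-identityˡ s ⟨
      1# * s                        ≈⟨ *-congʳ (≈-trans (≈-sym w-inverse) (*-comm _ w)) ⟩
      w * (1# - v) * s              ≈⟨ *-assoc _ _ _ ⟩
      w * ((1# - v) * s)            ≈⟨ *-congˡ (geometric-sum v m f (λ k → ≈-reflexive (cong (pow v) (ℕₚ.+-suc h k)))) ⟩
      w * (f 0 - f m)               ≡⟨ cong₂ (λ x y → w * (pow v x - pow v y)) (ℕₚ.+-identityʳ h) (ℕₚ.m+[n∸m]≡n h≤) ⟩
      w * (pow v h - pow v (suc n)) ∎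
      where
      m = suc n ∸ h
      f : ℕ → Carrier
      f k = pow v (h +ℕ k)
      s = sumList (applyUpTo f m)

    -- The child with `j` equal to the first letter exists exactly when `pairW v σ` is not set to
    -- zero; the larger letters give the geometric sum.
    pairW-children : ∀ {n σ} → Valid (suc n) σ → ∑ (pairW v) (children (suc n) σ) ≈
      p * r * pairW v σ + p * q * v * w * (placed v σ - pow v (suc n) * weight σ)
    pairW-children {n} {[]}        V = contradiction (valid-[] V) λ ()
    pairW-children {n} {zero ∷ t}  V = contradiction (proj₁ (All.head (letters V))) λ ()
    pairW-children {n} {suc h ∷ t} V = begin
      pairW v (second (suc h) t) + ∑ (pairW v) (map (λ j → front j σ) js)
        ≈⟨ +-congʳ (≈-reflexive (pairW-false v (second (suc h) t) (starts-pair-second (suc h) t))) ⟩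
      0# + ∑ (pairW v) (map (λ j → front j σ) js)
        ≈⟨ +-identityˡ _ ⟩
      ∑ (pairW v) (map (λ j → front j σ) js)
        ≡⟨ cong sumList (sym (map-∘ js)) ⟩
      ∑ (λ j → pairW v (front j σ)) js
        ≈⟨ ∑-cong {xs = js} (All.tabulate λ {j} _ → ≈-reflexive (pairW-true v (front j σ) (starts-pair-front j σ))) ⟩
      ∑ F js
        ≈⟨ split ⟩
      p * r * pairW v σ + ∑ F new
        ≈⟨ +-congˡ maxima ⟩
      p * r * pairW v σ + p * q * v * w * (placed v σ - pow v (suc n) * weight σ) ∎
      where
      σ = suc h ∷ t
      js = pair-letters (suc n) (suc h) t
      new = larger-letters (suc n) (suc h)
      F : ℕ → Carrier
      F j = placed v (front j σ)
      split : ∑ F js ≈ p * r * pairW v σ + ∑ F new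
      split with starts-pair σ
      ... | true  = +-congʳ (≈-trans (*-congʳ (weight-front-equal (suc h) t)) (*-assoc _ _ _))
      ... | false = ≈-sym (≈-trans (+-congʳ (zeroʳ _)) (+-identityˡ _))
      maxima : ∑ F new ≈ p * q * v * w * (placed v σ - pow v (suc n) * weight σ)
      maxima = begin
        ∑ F new
          ≈⟨ ∑-cong {xs = new} (All.tabulate λ j∈ → *-congʳ (weight-front-bigger t (proj₁ (∈-larger-letters⁻ j∈)))) ⟩
        ∑ (λ j → p * q * weight σ * pow v (pred j)) new
          ≈⟨ ∑-*ˡ (p * q * weight σ) (λ j → pow v (pred j)) new ⟩
        p * q * weight σ * ∑ (λ j → pow v (pred j)) new
          ≈⟨ *-congˡ (larger-letters-sum (ℕₚ.m≤n⇒m≤1+n (proj₂ (All.head (letters V))))) ⟩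
        -- One factor `v` is taken out to leave the parent's own marking `pow v h` and, at the upper
        -- end, `v` to the order of `σ`, which is the substitution of xv for x.
        p * q * weight σ * (w * (v * pow v h - v * pow v (suc n)))
          ≈⟨ *-congˡ (*-congˡ (x[y-z]≈xy-xz v _ _)) ⟨
        p * q * weight σ * (w * (v * (pow v h - pow v (suc n))))
          ≈⟨ S.solve 6 (λ p q v w a d → p :* q :* a :* (w :* (v :* d)) := p :* q :* v :* w :* (a :* d)) ≈-refl p q v w _ _ ⟩
        p * q * v * w * (weight σ * (pow v h - pow v (suc n)))
          ≈⟨ *-congˡ (≈-trans (x[y-z]≈xy-xz _ _ _) (+-congˡ (-‿cong (*-comm _ _)))) ⟩
        p * q * v * w * (placed v σ - pow v (suc n) * weight σ) ∎

  -- Coefficients of L and N as sums over words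

  starts-with : ℕ → List ℕ → Bool
  starts-with i (a ∷ b ∷ _) = (a ≡ᵇ i) ∧ (b ≡ᵇ i)
  starts-with i _           = false

  gii-sum : ∀ n i → gii n i ≈ ∑ (λ w → if starts-with i w then weight w else 0#) (Q132 n)
  gii-sum n i = ≈-trans (∑-filter weight _ (Q132 n)) (∑-cong {xs = Q132 n} (All.tabulate λ {w} _ → same w))
    where
    -- The test in `Q132ii` is local there; exposing the first two letters makes it evaluate to the
    -- same Boolean as `starts-with`.
    same : ∀ w → _ ≈ (if starts-with i w then weight w else 0#)
    same []          = ≈-refl
    same (a ∷ [])    = ≈-refl
    same (a ∷ b ∷ w) = ≈-refl

  -- Only the index one below the first letter can contribute, and it does so when the second letter
  -- agrees; the sum over letters thus becomes the marking power of `v`.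
  starts-with-sum : ∀ v {n} w → All (Letter n) w →
    sumTo n (λ k → (if starts-with (suc k) w then weight w else 0#) * pow v k) ≈ pairW v w
  starts-with-sum v {n} []       _ = sumTo-0 n (λ _ _ → zeroˡ _)
  starts-with-sum v {n} (a ∷ []) _ = sumTo-0 n (λ _ _ → zeroˡ _)
  starts-with-sum v {n} (zero ∷ b ∷ w) ((() , _) ∷ _)
  starts-with-sum v {n} (suc a ∷ b ∷ w) ((_ , a<n) ∷ _) = ≈-trans (sumTo-single n a a<n other) this
    where
    other : ∀ k → k ≢ a → (if (a ≡ᵇ k) ∧ (b ≡ᵇ suc k) then weight (suc a ∷ b ∷ w) else 0#) * pow v k ≈ 0#
    other k k≢a rewrite ≢⇒≡ᵇ-false a k (k≢a ∘ sym) = zeroˡ _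
    this : (if (a ≡ᵇ a) ∧ (b ≡ᵇ suc a) then weight (suc a ∷ b ∷ w) else 0#) * pow v a ≈ pairW v (suc a ∷ b ∷ w)
    this with suc a ℕₚ.≟ b
    ... | yes refl rewrite ≡ᵇ-refl a = ≈-refl
    ... | no  a≢b  rewrite ≡ᵇ-refl a | ≢⇒≡ᵇ-false b (suc a) (a≢b ∘ sym) | ≢⇒≡ᵇ-false (suc a) b a≢b = zeroˡ _

  Ln-sum : ∀ v n → Ln v n ≈ ∑ (pairW v) (Q132 n)
  Ln-sum v n = begin
    sumTo n (λ k → gii n (suc k) * pow v k)
      ≈⟨ sumTo-cong n (λ k _ → ≈-trans (*-congʳ (gii-sum n (suc k))) (∑-*ʳ (pow v k) _ (Q132 n))) ⟩
    sumTo n (λ k → ∑ (λ w → (if starts-with (suc k) w then weight w else 0#) * pow v k) (Q132 n))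
      ≈⟨ sumTo-∑ n _ (Q132 n) ⟩
    ∑ (λ w → sumTo n (λ k → (if starts-with (suc k) w then weight w else 0#) * pow v k)) (Q132 n)
      ≈⟨ ∑-cong {xs = Q132 n} (All.tabulate λ {w} w∈ → starts-with-sum v w (letters (∈-Q132⁻ {n} w∈))) ⟩
    ∑ (pairW v) (Q132 n) ∎

  N : Carrier → PS
  N v zero    = 0#
  N v (suc n) = ∑ (soloW v) (Q132 (suc n))

  L+N : ∀ v n → (L v ⊕ N v) (suc n) ≈ ∑ (placed v) (Q132 (suc n))
  L+N v n = begin
    Ln v (suc n) + N v (suc n)                        ≈⟨ +-congʳ (Ln-sum v (suc n)) ⟩
    ∑ (pairW v) Q + ∑ (soloW v) Q                     ≈⟨ ∑-+ (pairW v) (soloW v) Q ⟨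
    ∑ (λ w → pairW v w + soloW v w) Q                 ≈⟨ ∑-cong {xs = Q} (All.tabulate λ {w} _ → pair+solo v w) ⟩
    ∑ (placed v) Q                                    ∎
    where Q = Q132 (suc n)

  g-sum : ∀ n → g (suc n) ≈ (L 1# ⊕ N 1#) (suc n)
  g-sum n = ≈-sym (≈-trans (L+N 1# n)
    (∑-cong {xs = Q132 (suc n)} (All.tabulate λ {w} _ → ≈-trans (*-congˡ (pow-1 (pred (at w 0)))) (*-identityʳ _))))

  N-suc : ∀ v n → N v (suc n) ≈ q * r * L v n + p * r * N v n
  -- The only word of order 1 is a pair, and both series vanish at index 0.
  N-suc v zero    = ≈-trans (+-identityʳ 0#) (≈-sym (≈-trans (+-cong (zeroʳ _) (zeroʳ _)) (+-identityʳ 0#)))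
  N-suc v (suc n) = begin
    ∑ (soloW v) (Q132 (suc (suc n)))
      ≈⟨ ∑Q132-suc (suc n) (soloW v) ⟩
    ∑ (λ σ → ∑ (soloW v) (children (suc n) σ)) Q
      ≈⟨ ∑-cong {xs = Q} (All.tabulate λ {σ} σ∈ → soloW-children v (∈-Q132⁻ σ∈)) ⟩
    ∑ (λ σ → q * r * pairW v σ + p * r * soloW v σ) Q
      ≈⟨ ∑-+ _ _ Q ⟩
    ∑ (λ σ → q * r * pairW v σ) Q + ∑ (λ σ → p * r * soloW v σ) Q
      ≈⟨ +-cong (∑-*ˡ _ _ Q) (∑-*ˡ _ _ Q) ⟩
    q * r * ∑ (pairW v) Q + p * r * ∑ (soloW v) Q
      ≈⟨ +-congʳ (*-congˡ (Ln-sum v (suc n))) ⟨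
    q * r * L v (suc n) + p * r * N v (suc n) ∎
    where Q = Q132 (suc n)

  N-equation : ∀ v → N v ≋ ⟨ q * r ⟩ ⊗ X ⊗ L v ⊕ ⟨ p * r ⟩ ⊗ X ⊗ N v
  N-equation v zero    = ≈-sym (≈-trans (+-cong (aX-zero _ (L v)) (aX-zero _ (N v))) (+-identityʳ 0#))
  N-equation v (suc n) = ≈-trans (N-suc v n) (≈-sym (+-cong (aX-suc _ (L v) n) (aX-suc _ (N v) n)))

  -- N(xv; 1), the counterpart of Lxv1
  Nxv1 : Carrier → PS
  Nxv1 v n = pow v n * N 1# n

  -- Substituting xv for x multiplies the coefficient at `n` by `pow v n`, so each shift by x picks
  -- up one more factor `v`.
  Nxv1-equation : ∀ v → Nxv1 v ≋ ⟨ q * r * v ⟩ ⊗ X ⊗ Lxv1 v ⊕ ⟨ p * r * v ⟩ ⊗ X ⊗ Nxv1 v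
  Nxv1-equation v zero    = ≈-trans (zeroʳ _)
    (≈-sym (≈-trans (+-cong (aX-zero _ (Lxv1 v)) (aX-zero _ (Nxv1 v))) (+-identityʳ 0#)))
  Nxv1-equation v (suc n) = begin
    pow v (suc n) * N 1# (suc n)
      ≈⟨ *-congˡ (N-suc 1# n) ⟩
    v * pow v n * (q * r * L 1# n + p * r * N 1# n)
      ≈⟨ S.solve 7 (λ p q r v x l m → v :* x :* (q :* r :* l :+ p :* r :* m) := q :* r :* v :* (x :* l) :+ p :* r :* v :* (x :* m)) ≈-refl p q r v _ _ _ ⟩
    q * r * v * Lxv1 v n + p * r * v * Nxv1 v n
      ≈⟨ +-cong (aX-suc _ (Lxv1 v) n) (aX-suc _ (Nxv1 v) n) ⟨
    (⟨ q * r * v ⟩ ⊗ X ⊗ Lxv1 v ⊕ ⟨ p * r * v ⟩ ⊗ X ⊗ Nxv1 v) (suc n) ∎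

  -- Elimination among the series

  ⟨⟩X-difference : ∀ {a b c} → c ≈ a - b → ⟨ c ⟩ ⊗ X ≋ ⟨ a ⟩ ⊗ X ⊖ ⟨ b ⟩ ⊗ X
  ⟨⟩X-difference {a} {b} {c} c≈ n = begin
    (⟨ c ⟩ ⊗ X) n                      ≈⟨ ⟨⟩-⊗ c X n ⟩
    c * X n                            ≈⟨ *-congʳ c≈ ⟩
    (a - b) * X n                      ≈⟨ [y-z]x≈yx-zx (X n) a b ⟩
    a * X n - b * X n                  ≈⟨ +-cong (⟨⟩-⊗ a X n) (-‿cong (⟨⟩-⊗ b X n)) ⟨
    (⟨ a ⟩ ⊗ X) n - (⟨ b ⟩ ⊗ X) n      ∎

  r[q-p]X : ⟨ r * (q - p) ⟩ ⊗ X ≋ ⟨ q * r ⟩ ⊗ X ⊖ ⟨ p * r ⟩ ⊗ X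
  r[q-p]X = ⟨⟩X-difference (≈-trans (*-comm _ _) ([y-z]x≈yx-zx r q p))

  [q-p]rvX : ∀ v → ⟨ (q - p) * r * v ⟩ ⊗ X ≋ ⟨ q * r * v ⟩ ⊗ X ⊖ ⟨ p * r * v ⟩ ⊗ X
  [q-p]rvX v = ⟨⟩X-difference (≈-trans (*-congʳ ([y-z]x≈yx-zx r q p)) ([y-z]x≈yx-zx v _ _))

  module PSR = CommutativeRing seriesRing
  open RingLemmas seriesRing using (linear-kernel; linear-solution; kernel-equation)

  C132-formula : C132 ≋ ⟨ 1# ⟩ ⊕ (⟨ 1# ⟩ ⊕ ⟨ r * (q - p) ⟩ ⊗ X) ⊗ geom (p * r) ⊗ L 1#
  C132-formula = PSR.trans C132≋ (PSR.+-congˡ {x = ⟨ 1# ⟩}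
    (linear-solution {G = geom (p * r)} {L 1#} {N 1#} r[q-p]X (geom-inverse (p * r)) (N-equation 1#)))
    where
    C132≋ : C132 ≋ ⟨ 1# ⟩ ⊕ (L 1# ⊕ N 1#)
    C132≋ zero    = +-cong (≈-trans (*-identityʳ _) (*-identityʳ _)) (≈-sym (+-identityʳ 0#))
    C132≋ (suc n) = ≈-trans (g-sum n) (≈-sym (+-identityˡ _))

  module _ (v w : Carrier) (w-inverse : (1# - v) * w ≈ 1#) where

    private
      D D′ : PS
      D  = L v ⊕ N v
      D′ = Lxv1 v ⊕ Nxv1 v
      e = p * q * v * w

    -- Starts at order 2: the word of order 1 is the child of the empty word and enters `L-equation`
    -- as the term px.
    L-suc : ∀ n → L v (suc (suc n)) ≈ e * (D (suc n) - D′ (suc n)) + p * r * L v (suc n)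
    L-suc n = begin
      Ln v (suc (suc n))
        ≈⟨ Ln-sum v (suc (suc n)) ⟩
      ∑ (pairW v) (Q132 (suc (suc n)))
        ≈⟨ ∑Q132-suc (suc n) (pairW v) ⟩
      ∑ (λ σ → ∑ (pairW v) (children (suc n) σ)) Q
        ≈⟨ ∑-cong {xs = Q} (All.tabulate λ {σ} σ∈ → pairW-children v w w-inverse (∈-Q132⁻ σ∈)) ⟩
      ∑ (λ σ → p * r * pairW v σ + e * (placed v σ - x * weight σ)) Q
        ≈⟨ ∑-+ _ _ Q ⟩
      ∑ (λ σ → p * r * pairW v σ) Q + ∑ (λ σ → e * (placed v σ - x * weight σ)) Q
        ≈⟨ +-cong (∑-*ˡ _ _ Q) (∑-*ˡ _ _ Q) ⟩
      p * r * ∑ (pairW v) Q + e * ∑ (λ σ → placed v σ - x * weight σ) Q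
        ≈⟨ +-cong (*-congˡ (≈-sym (Ln-sum v (suc n)))) (*-congˡ difference) ⟩
      p * r * L v (suc n) + e * (D (suc n) - D′ (suc n))
        ≈⟨ +-comm _ _ ⟩
      e * (D (suc n) - D′ (suc n)) + p * r * L v (suc n) ∎
      where
      Q = Q132 (suc n)
      x = pow v (suc n)
      -- The unmarked weights sum to `g (suc n)`, which is the coefficient of L + N at v = 1; the
      -- power `x` of `v` turns it into that of `D′`.
      difference : ∑ (λ σ → placed v σ - x * weight σ) Q ≈ D (suc n) - D′ (suc n)
      difference = begin
        ∑ (λ σ → placed v σ - x * weight σ) Q               ≈⟨ ∑-+ _ _ Q ⟩
        ∑ (placed v) Q + ∑ (λ σ → - (x * weight σ)) Q       ≈⟨ +-congˡ (∑-neg _ Q) ⟩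
        ∑ (placed v) Q - ∑ (λ σ → x * weight σ) Q           ≈⟨ +-cong (≈-sym (L+N v n)) (-‿cong (∑-*ˡ x weight Q)) ⟩
        D (suc n) - x * g (suc n)                           ≈⟨ +-congˡ (-‿cong (*-congˡ (g-sum n))) ⟩
        D (suc n) - x * (L 1# (suc n) + N 1# (suc n))       ≈⟨ +-congˡ (-‿cong (distribˡ x _ _)) ⟩
        D (suc n) - D′ (suc n)                              ∎

    L-equation : L v ≋ (⟨ p ⟩ ⊗ X ⊕ ⟨ e ⟩ ⊗ X ⊗ (D ⊖ D′)) ⊕ ⟨ p * r ⟩ ⊗ X ⊗ L v
    L-equation zero = ≈-sym (begin
      ((⟨ p ⟩ ⊗ X) 0 + (⟨ e ⟩ ⊗ X ⊗ (D ⊖ D′)) 0) + (⟨ p * r ⟩ ⊗ X ⊗ L v) 0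
        ≈⟨ +-cong (+-cong (≈-trans (⟨⟩-⊗ p X 0) (zeroʳ p)) (aX-zero e (D ⊖ D′))) (aX-zero _ (L v)) ⟩
      (0# + 0#) + 0#
        ≈⟨ ≈-trans (+-identityʳ _) (+-identityʳ 0#) ⟩
      0# ∎)
    L-equation (suc zero) = begin
      Ln v 1
        ≈⟨ Ln-sum v 1 ⟩
      p * 1# * 1# * 1# * 1# + 0#
        ≈⟨ S.solve 1 (λ p → p :* S.con 1 :* S.con 1 :* S.con 1 :* S.con 1 :+ S.con 0 := p) ≈-refl p ⟩
      p
        ≈⟨ *-identityʳ p ⟨
      p * 1#
        ≈⟨ ≈-trans (+-identityʳ _) (+-identityʳ _) ⟨
      (p * 1# + 0#) + 0#
        ≈⟨ +-cong (+-cong (⟨⟩-⊗ p X 1) (≈-trans (aX-suc e (D ⊖ D′) 0) (≈-trans (*-congˡ D₀) (zeroʳ e))))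
                  (≈-trans (aX-suc _ (L v) 0) (zeroʳ _)) ⟨
      ((⟨ p ⟩ ⊗ X) 1 + (⟨ e ⟩ ⊗ X ⊗ (D ⊖ D′)) 1) + (⟨ p * r ⟩ ⊗ X ⊗ L v) 1 ∎
      where
      D₀ : (D ⊖ D′) 0 ≈ 0#
      D₀ = ≈-trans (+-congˡ (-‿cong (+-cong (zeroʳ _) (zeroʳ _)))) (-‿inverseʳ (0# + 0#))
    L-equation (suc (suc n)) = begin
      L v (suc (suc n))
        ≈⟨ L-suc n ⟩
      e * (D ⊖ D′) (suc n) + p * r * L v (suc n)
        ≈⟨ +-congʳ (+-identityˡ _) ⟨
      (0# + e * (D ⊖ D′) (suc n)) + p * r * L v (suc n)
        ≈⟨ +-cong (+-cong (≈-trans (⟨⟩-⊗ p X (suc (suc n))) (zeroʳ p)) (aX-suc e (D ⊖ D′) (suc n))) (aX-suc _ (L v) (suc n)) ⟨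
      ((⟨ p ⟩ ⊗ X) (suc (suc n)) + (⟨ e ⟩ ⊗ X ⊗ (D ⊖ D′)) (suc (suc n))) + (⟨ p * r ⟩ ⊗ X ⊗ L v) (suc (suc n)) ∎

    L-formula : ((⟨ 1# ⟩ ⊖ ⟨ p * r ⟩ ⊗ X) ⊗ (⟨ 1# ⟩ ⊖ ⟨ p * r ⟩ ⊗ X)
                   ⊖ ⟨ p * q * v * w ⟩ ⊗ X ⊗ (⟨ 1# ⟩ ⊕ ⟨ r * (q - p) ⟩ ⊗ X)) ⊗ L v
                ≋ ⟨ p ⟩ ⊗ X ⊗ (⟨ 1# ⟩ ⊖ ⟨ p * r ⟩ ⊗ X)
                  ⊖ ⟨ p * q * v * w ⟩ ⊗ X ⊗ (⟨ 1# ⟩ ⊖ ⟨ p * r ⟩ ⊗ X)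
                    ⊗ (⟨ 1# ⟩ ⊕ ⟨ (q - p) * r * v ⟩ ⊗ X) ⊗ geom (p * r * v) ⊗ Lxv1 v
    L-formula = PSR.trans
      (kernel-equation {b = ⟨ p * r ⟩ ⊗ X} {⟨ e ⟩ ⊗ X} {⟨ 1# ⟩ ⊕ ⟨ r * (q - p) ⟩ ⊗ X} {⟨ p ⟩ ⊗ X} {L v} {D} {D′}
        L-equation (linear-kernel {L = L v} {N v} r[q-p]X (N-equation v)))
      -- Only `D′` is left to resolve. Its equation has the parameters multiplied by `v`, so solving
      -- it brings in `geom (p * r * v)`, while the factor `K` in front stays.
      (PSR.+-congˡ {x = ⟨ p ⟩ ⊗ X ⊗ K} (PSR.-‿cong (PSR.trans
        (PSR.*-congˡ {x = E} (linear-solution {G = G} {Lxv1 v} {Nxv1 v} ([q-p]rvX v) (geom-inverse (p * r * v)) (Nxv1-equation v)))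
        (PSR.trans (PSR.sym (⊗-assoc E (A ⊗ G) (Lxv1 v)))
          (PSR.*-congʳ {x = Lxv1 v} (PSR.sym (⊗-assoc E A G)))))))
      where
      K = ⟨ 1# ⟩ ⊖ ⟨ p * r ⟩ ⊗ X
      E = ⟨ e ⟩ ⊗ X ⊗ K
      A = ⟨ 1# ⟩ ⊕ ⟨ (q - p) * r * v ⟩ ⊗ X
      G = geom (p * r * v)

theorem2p10 : ∀ {c ℓ : Level} (R : CommutativeRing c ℓ) (p q r : CommutativeRing.Carrier R) →
    let open CommutativeRing R
        open Series R
        open Stirling p q r
    in (C132 ≋ ⟨ 1# ⟩ ⊕ (⟨ 1# ⟩ ⊕ ⟨ r * (q - p) ⟩ ⊗ X) ⊗ geom (p * r) ⊗ L 1#)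
       × (∀ (v w : Carrier) → (1# - v) * w ≈ 1# →
            ((⟨ 1# ⟩ ⊖ ⟨ p * r ⟩ ⊗ X) ⊗ (⟨ 1# ⟩ ⊖ ⟨ p * r ⟩ ⊗ X)
               ⊖ ⟨ p * q * v * w ⟩ ⊗ X ⊗ (⟨ 1# ⟩ ⊕ ⟨ r * (q - p) ⟩ ⊗ X)) ⊗ L v
            ≋ ⟨ p ⟩ ⊗ X ⊗ (⟨ 1# ⟩ ⊖ ⟨ p * r ⟩ ⊗ X)
              ⊖ ⟨ p * q * v * w ⟩ ⊗ X ⊗ (⟨ 1# ⟩ ⊖ ⟨ p * r ⟩ ⊗ X)
                ⊗ (⟨ 1# ⟩ ⊕ ⟨ (q - p) * r * v ⟩ ⊗ X) ⊗ geom (p * r * v) ⊗ Lxv1 v)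
theorem2p10 R p q r = C132-formula , L-formula
  where open Recurrences R p q r
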